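{- For every set $T$, the category $\mathsf{FRg}(T)$ is the free regular category on $T$; i.e. there is an adjunction between $\mathsf{Set}$ and $\mathsf{RgCat}$ whose left adjoint is $\mathsf{FRg}(-)\colon\mathsf{Set}\to\mathsf{RgCat}$ and whose right adjoint is $\mathrm{Ob}\colon\mathsf{RgCat}\to\mathsf{Set}$.
   Context: A regular category is a category with all finite limits, in which the kernel pair of every morphism has a coequalizer, and in which the pullback of a regular epimorphism along any map is again a regular epimorphism. A regular functor is a functor between regular categories preserving finite limits and regular epimorphisms. $\mathsf{RgCat}$ is the category of regular categories and regular functors, and $\mathrm{Ob}$ sends a regular category to its set of objects. $\mathsf{Set}$ is the category of sets and functions. For a set $T$, $\mathsf{FRg}(T)$ is the comma category of the inclusion $\mathbb P_f(T)^{op}\to\mathsf{FinSet}^{op}$ (where $\mathbb P_f(T)$ is the poset of finite subsets of $T$ and $\mathsf{FinSet}$ is the category of finite sets) over the identity of $\mathsf{FinSet}^{op}$. Concretely (working in a skeleton), objects are triples $\Gamma=(n,S,\tau)$ with $n\in\mathbb N$, $S\subseteq T$ finite and $\tau\colon\underline n\to S$ a function, where $\underline n=\{1,\dots,n\}$; a morphism $(n,S,\tau)\to(n',S',\tau')$ exists only if $S'\subseteq S$, and is then a function $f\colon\underline n'\to\underline n$ such that $\tau(f(i))=\tau'(i)$ for all $i\in\underline n'$. Composition is composition of functions (in the opposite direction). This is a regular category. On a function $g\colon T\to T'$, the induced regular functor $\mathsf{FRg}(g)\colon\mathsf{FRg}(T)\to\mathsf{FRg}(T')$ sends $(n,S,\tau)$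 to $(n,g(S),g\circ\tau)$.
   Formalization: Regular functors are compared up to natural isomorphism, not equality: strictly the adjunction fails, since regular functors FRg(∅)→R are the terminal objects of R. The hom-bijection becomes: every T→Ob R extends, and isomorphisms on generators extend uniquely. -}

{-# OPTIONS --with-K #-}
module Defs where

open import Level using (Level; _⊔_; suc; 0ℓ; Lift; lift; lower)
open import Data.Nat.Base using (ℕ)
open import Data.Fin.Base using (Fin)
open import Data.List.Base using (List; map)
open import Data.List.Membership.Propositional using (_∈_)
open import Data.List.Membership.Propositional.Properties using (∈-map⁺)
open import Data.List.Relation.Binary.Subset.Propositional using (_⊆_)
open import Data.List.Relation.Binary.Subset.Propositional.Properties as Subset using ()
open import Data.Product using (Σ; ∃; ∃!; _×_; _,_)
open import Function.Base as Fun using (id)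
open import Relation.Binary.Bundles using (Setoid)
open import Relation.Binary.Structures using (IsEquivalence)
open import Relation.Binary.PropositionalEquality as ≡ using (_≡_; refl; cong; trans)
import Relation.Binary.Reasoning.Setoid as SetoidReasoning

------------------------------------------------------------------------
-- Categories (with hom-setoids), functors, natural isomorphisms

record Category (o ℓ e : Level) : Set (suc (o ⊔ ℓ ⊔ e)) where
  infix  4 _≈_
  infixr 9 _∘_
  field
    Obj       : Set o
    Hom       : Obj → Obj → Set ℓ
    _≈_       : ∀ {A B} → Hom A B → Hom A B → Set e
    idn       : ∀ {A} → Hom A A
    _∘_       : ∀ {A B C} → Hom B C → Hom A B → Hom A C
    equiv     : ∀ {A B} → IsEquivalence (_≈_ {A} {B})
    ∘-resp-≈  : ∀ {A B C} {f f′ : Hom B C} {g g′ : Hom A B} →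
                f ≈ f′ → g ≈ g′ → f ∘ g ≈ f′ ∘ g′
    assoc     : ∀ {A B C D} {f : Hom A B} {g : Hom B C} {h : Hom C D} →
                (h ∘ g) ∘ f ≈ h ∘ (g ∘ f)
    identityˡ : ∀ {A B} {f : Hom A B} → idn ∘ f ≈ f
    identityʳ : ∀ {A B} {f : Hom A B} → f ∘ idn ≈ f

  hom-setoid : (A B : Obj) → Setoid ℓ e
  hom-setoid A B = record { Carrier = Hom A B ; _≈_ = _≈_ ; isEquivalence = equiv }

  module Equiv {A B : Obj} = IsEquivalence (equiv {A} {B})

record Functor {o ℓ e o′ ℓ′ e′ : Level}
               (C : Category o ℓ e) (D : Category o′ ℓ′ e′) :
               Set (o ⊔ ℓ ⊔ e ⊔ o′ ⊔ ℓ′ ⊔ e′) where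
  private
    module C = Category C
    module D = Category D
  field
    F₀           : C.Obj → D.Obj
    F₁           : ∀ {A B} → C.Hom A B → D.Hom (F₀ A) (F₀ B)
    F-resp-≈     : ∀ {A B} {f g : C.Hom A B} → f C.≈ g → F₁ f D.≈ F₁ g
    identity     : ∀ {A} → F₁ (C.idn {A}) D.≈ D.idn
    homomorphism : ∀ {X Y Z} {f : C.Hom X Y} {g : C.Hom Y Z} →
                   F₁ (g C.∘ f) D.≈ F₁ g D.∘ F₁ f

idF : ∀ {o ℓ e} {C : Category o ℓ e} → Functor C C
idF {C = C} = record
  { F₀           = id
  ; F₁           = id
  ; F-resp-≈     = id
  ; identity     = Equiv.refl
  ; homomorphism = Equiv.refl
  } where open Category C

infixr 9 _∘F_

_∘F_ : ∀ {o ℓ e o′ ℓ′ e′ o″ ℓ″ e″}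
         {C : Category o ℓ e} {D : Category o′ ℓ′ e′} {E : Category o″ ℓ″ e″} →
       Functor D E → Functor C D → Functor C E
_∘F_ {E = E} G F = record
  { F₀           = λ A → G.F₀ (F.F₀ A)
  ; F₁           = λ f → G.F₁ (F.F₁ f)
  ; F-resp-≈     = λ p → G.F-resp-≈ (F.F-resp-≈ p)
  ; identity     = Equiv.trans (G.F-resp-≈ F.identity) G.identity
  ; homomorphism = Equiv.trans (G.F-resp-≈ F.homomorphism) G.homomorphism
  }
  where
    open Category E
    module G = Functor G
    module F = Functor F

record Iso {o ℓ e : Level} (C : Category o ℓ e) (A B : Category.Obj C) : Set (ℓ ⊔ e) where
  open Category C
  field
    to   : Hom A B
    from : Hom B A
    isoˡ : from ∘ to ≈ idn
    isoʳ : to ∘ from ≈ idn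

infix 4 _≃_

record _≃_ {o ℓ e o′ ℓ′ e′ : Level} {C : Category o ℓ e} {D : Category o′ ℓ′ e′}
           (F G : Functor C D) : Set (o ⊔ ℓ ⊔ ℓ′ ⊔ e′) where
  private
    module C = Category C
    module F = Functor F
    module G = Functor G
  open Category D
  field
    iso : ∀ A → Iso D (F.F₀ A) (G.F₀ A)

  to : ∀ A → Hom (F.F₀ A) (G.F₀ A)
  to A = Iso.to (iso A)

  field
    natural : ∀ {A B} (f : C.Hom A B) → to B ∘ F.F₁ f ≈ G.F₁ f ∘ to A

------------------------------------------------------------------------
-- Finite limits

record Cone {o ℓ e o′ ℓ′ e′ : Level} {J : Category o ℓ e} {C : Category o′ ℓ′ e′}
            (D : Functor J C) : Set (o ⊔ ℓ ⊔ o′ ⊔ ℓ′ ⊔ e′) where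
  private
    module J = Category J
    module D = Functor D
  open Category C
  field
    apex    : Obj
    ψ       : ∀ j → Hom apex (D.F₀ j)
    commute : ∀ {j k} (u : J.Hom j k) → D.F₁ u ∘ ψ j ≈ ψ k

IsLimit : ∀ {o ℓ e o′ ℓ′ e′} {J : Category o ℓ e} {C : Category o′ ℓ′ e′}
            {D : Functor J C} → Cone D → Set (o ⊔ ℓ ⊔ o′ ⊔ ℓ′ ⊔ e′)
IsLimit {C = C} {D = D} L =
  (K : Cone D) → ∃! (_≈_ {Cone.apex K} {L.apex}) λ u → ∀ j → L.ψ j ∘ u ≈ Cone.ψ K j
  where
    open Category C
    module L = Cone L

mapCone : ∀ {o ℓ e o′ ℓ′ e′ o″ ℓ″ e″}
            {J : Category o ℓ e} {C : Category o′ ℓ′ e′} {C′ : Category o″ ℓ″ e″}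
            {D : Functor J C} (F : Functor C C′) → Cone D → Cone (F ∘F D)
mapCone {C′ = C′} F K = record
  { apex    = F.F₀ K.apex
  ; ψ       = λ j → F.F₁ (K.ψ j)
  ; commute = λ u → Equiv.trans (Equiv.sym F.homomorphism) (F.F-resp-≈ (K.commute u))
  }
  where
    open Category C′
    module F = Functor F
    module K = Cone K

-- Every category with finitely many objects and morphisms is isomorphic to
-- one whose sets of objects and of morphisms are of the form Fin n.
record FiniteCategory : Set where
  infixr 9 _∘_
  field
    #obj      : ℕ
    #hom      : Fin #obj → Fin #obj → ℕ
    idn       : ∀ {i} → Fin (#hom i i)
    _∘_       : ∀ {i j k} → Fin (#hom j k) → Fin (#hom i j) → Fin (#hom i k)
    assoc     : ∀ {i j k l} {f : Fin (#hom i j)} {g : Fin (#hom j k)} {h : Fin (#hom k l)} →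
                (h ∘ g) ∘ f ≡ h ∘ (g ∘ f)
    identityˡ : ∀ {i j} {f : Fin (#hom i j)} → idn ∘ f ≡ f
    identityʳ : ∀ {i j} {f : Fin (#hom i j)} → f ∘ idn ≡ f

  category : Category 0ℓ 0ℓ 0ℓ
  category = record
    { Obj       = Fin #obj
    ; Hom       = λ i j → Fin (#hom i j)
    ; _≈_       = _≡_
    ; idn       = idn
    ; _∘_       = _∘_
    ; equiv     = ≡.isEquivalence
    ; ∘-resp-≈  = ≡.cong₂ _∘_
    ; assoc     = assoc
    ; identityˡ = identityˡ
    ; identityʳ = identityʳ
    }

------------------------------------------------------------------------
-- Regular categories and regular functors

module _ {o ℓ e : Level} (C : Category o ℓ e) where
  open Category C

  IsPullback : ∀ {P A B Z} → Hom P A → Hom P B → Hom A Z → Hom B Z → Set (o ⊔ ℓ ⊔ e)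
  IsPullback {P} {A} {B} p q f g =
    (f ∘ p ≈ g ∘ q) ×
    (∀ {X} (h : Hom X A) (k : Hom X B) → f ∘ h ≈ g ∘ k →
       ∃! (_≈_ {X} {P}) λ u → (p ∘ u ≈ h) × (q ∘ u ≈ k))

  IsKernelPair : ∀ {K A B} → Hom K A → Hom K A → Hom A B → Set (o ⊔ ℓ ⊔ e)
  IsKernelPair p q f = IsPullback p q f f

  IsCoequalizer : ∀ {K A Q} → Hom K A → Hom K A → Hom A Q → Set (o ⊔ ℓ ⊔ e)
  IsCoequalizer {K} {A} {Q} p q c =
    (c ∘ p ≈ c ∘ q) ×
    (∀ {X} (h : Hom A X) → h ∘ p ≈ h ∘ q → ∃! (_≈_ {Q} {X}) λ u → u ∘ c ≈ h)

  IsRegularEpi : ∀ {A B} → Hom A B → Set (o ⊔ ℓ ⊔ e)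
  IsRegularEpi {A} c = Σ Obj λ K → Σ (Hom K A) λ p → Σ (Hom K A) λ q → IsCoequalizer p q c

  record IsRegular : Set (o ⊔ ℓ ⊔ e) where
    field
      finiteLimit : (J : FiniteCategory) (D : Functor (FiniteCategory.category J) C) →
                    ∃ λ (L : Cone D) → IsLimit L
      kernelPairCoequalizer :
        ∀ {K A B} {p q : Hom K A} {f : Hom A B} → IsKernelPair p q f →
        Σ Obj λ Q → ∃ λ (c : Hom A Q) → IsCoequalizer p q c
      regularEpiStable :
        ∀ {P A B Z} {p : Hom P A} {q : Hom P B} {f : Hom A Z} {g : Hom B Z} →
        IsPullback p q f g → IsRegularEpi f → IsRegularEpi q

record IsRegularFunctor {o ℓ e o′ ℓ′ e′ : Level}
                        {C : Category o ℓ e} {D : Category o′ ℓ′ e′}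
                        (F : Functor C D) : Set (o ⊔ ℓ ⊔ e ⊔ o′ ⊔ ℓ′ ⊔ e′) where
  private module C = Category C
  open Functor F
  field
    preservesFiniteLimits :
      (J : FiniteCategory) {E : Functor (FiniteCategory.category J) C} (L : Cone E) →
      IsLimit L → IsLimit (mapCone F L)
    preservesRegularEpis :
      ∀ {A B} {f : C.Hom A B} → IsRegularEpi C f → IsRegularEpi D (F₁ f)

record RegularCategory (a : Level) : Set (suc a) where
  field
    category  : Category a a a
    isRegular : IsRegular category

  open Category category public

record RegularFunctor {a : Level} (R R′ : RegularCategory a) : Set a where
  field
    functor   : Functor (RegularCategory.category R) (RegularCategory.category R′)
    isRegular : IsRegularFunctor functor

  open Functor functor public

------------------------------------------------------------------------
-- Adjunctions  L ⊣ Ob  between Set and RgCat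

Ob₀ : ∀ {a} → RegularCategory a → Set a
Ob₀ = RegularCategory.Obj

Ob₁ : ∀ {a} {R R′ : RegularCategory a} → RegularFunctor R R′ → Ob₀ R → Ob₀ R′
Ob₁ = RegularFunctor.F₀

-- Regular functors preserve finite limits and images only up to isomorphism,
-- so parallel regular functors are compared up to natural isomorphism: already
-- FRg ∅, the terminal category, has one regular functor to R for each terminal
-- object of R, but there is a single function ∅ → Ob R.  Functions are compared
-- up to pointwise equality.
record Set⟶RgCat (a : Level) : Set (suc a) where
  field
    L₀ : Set a → RegularCategory a
    L₁ : ∀ {T T′ : Set a} → (T → T′) → RegularFunctor (L₀ T) (L₀ T′)

  L₁F : ∀ {T T′ : Set a} → (T → T′) →
        Functor (RegularCategory.category (L₀ T)) (RegularCategory.category (L₀ T′))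
  L₁F g = RegularFunctor.functor (L₁ g)

record IsFunctorial {a : Level} (L : Set⟶RgCat a) : Set (suc a) where
  open Set⟶RgCat L
  field
    L-resp-≡       : ∀ {T T′ : Set a} {g h : T → T′} → (∀ t → g t ≡ h t) → L₁F g ≃ L₁F h
    L-identity     : ∀ {T : Set a} → L₁F (id {A = T}) ≃ idF
    L-homomorphism : ∀ {T T′ T″ : Set a} (g : T → T′) (h : T′ → T″) →
                     L₁F (λ t → h (g t)) ≃ L₁F h ∘F L₁F g

record _⊣Ob {a : Level} (L : Set⟶RgCat a) : Set (suc a) where
  open Set⟶RgCat L
  field
    functorial : IsFunctorial L

    η : (T : Set a) → T → Ob₀ (L₀ T)
    ε : (R : RegularCategory a) → RegularFunctor (L₀ (Ob₀ R)) R

  εF : (R : RegularCategory a) →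
       Functor (RegularCategory.category (L₀ (Ob₀ R))) (RegularCategory.category R)
  εF R = RegularFunctor.functor (ε R)

  field
    η-natural : ∀ {T T′ : Set a} (g : T → T′) (t : T) → Ob₁ (L₁ g) (η T t) ≡ η T′ (g t)
    ε-natural : ∀ {R R′ : RegularCategory a} (H : RegularFunctor R R′) →
                εF R′ ∘F L₁F (Ob₁ H) ≃ RegularFunctor.functor H ∘F εF R

    zig : (T : Set a) → εF (L₀ T) ∘F L₁F (η T) ≃ idF
    zag : (R : RegularCategory a) (x : Ob₀ R) → Ob₁ (ε R) (η (Ob₀ R) x) ≡ x

    -- The correspondence between regular functors L₀ T → R and functions
    -- T → Ob R extends to the isomorphisms between them.
    extendIso :
      ∀ {T : Set a} {R : RegularCategory a} (F G : RegularFunctor (L₀ T) R) →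
      let open RegularCategory R
          module F = RegularFunctor F
          module G = RegularFunctor G
      in (φ : ∀ t → Iso category (F.F₀ (η T t)) (G.F₀ (η T t))) →
         ∃! {A = F.functor ≃ G.functor}
            (λ α β → ∀ Γ → _≃_.to α Γ ≈ _≃_.to β Γ)
            (λ α → ∀ t → _≃_.to α (η T t) ≈ Iso.to (φ t))

------------------------------------------------------------------------
-- The category FRg T

-- Finite subsets of T are given by lists of their elements; only membership
-- matters, so different enumerations of a subset yield isomorphic contexts.
-- The map n → S is a map to T with values in S: maps to Σ T (_∈ S) would
-- distinguish repeated occurrences of an element of S.
record Context {a : Level} (T : Set a) : Set a where
  constructor ctx
  field
    n   : ℕ
    S   : List T
    τ   : Fin n → T
    τ∈S : ∀ i → τ i ∈ S

record _⇒_ {a : Level} {T : Set a} (Γ Γ′ : Context T) : Set a where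
  constructor mk⇒
  private
    module Γ  = Context Γ
    module Γ′ = Context Γ′
  field
    S′⊆S : Γ′.S ⊆ Γ.S
    fun  : Fin Γ′.n → Fin Γ.n
    τ-eq : ∀ i → Γ.τ (fun i) ≡ Γ′.τ i

-- Equality on T is proof-irrelevant (axiom K is in force), so every T : Set a
-- is a set and a morphism is determined by its underlying function.
FRg : ∀ {a} → Set a → Category a a a
FRg {a} T = record
  { Obj       = Context T
  ; Hom       = _⇒_
  ; _≈_       = λ f g → Lift a (∀ i → fun f i ≡ fun g i)
  ; idn       = mk⇒ id id (λ _ → refl)
  ; _∘_       = λ g f → mk⇒ (λ x∈S → S′⊆S f (S′⊆S g x∈S))
                            (λ i → fun f (fun g i))
                            (λ i → trans (τ-eq f (fun g i)) (τ-eq g i))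
  ; equiv     = record
    { refl  = lift λ _ → refl
    ; sym   = λ p → lift λ i → ≡.sym (lower p i)
    ; trans = λ p q → lift λ i → trans (lower p i) (lower q i)
    }
  ; ∘-resp-≈  = λ {_} {_} {_} {_} {g′} {f} p q →
                  lift λ i → trans (cong (fun f) (lower p i)) (lower q (fun g′ i))
  ; assoc     = lift λ _ → refl
  ; identityˡ = lift λ _ → refl
  ; identityʳ = lift λ _ → refl
  }
  where open _⇒_

FRg₁ : ∀ {a} {T T′ : Set a} → (T → T′) → Functor (FRg T) (FRg T′)
FRg₁ g = record
  { F₀           = λ (ctx n S τ τ∈S) → ctx n (map g S) (λ i → g (τ i)) (λ i → ∈-map⁺ g (τ∈S i))
  ; F₁           = λ (mk⇒ S′⊆S f τ-eq) → mk⇒ (Subset.map⁺ g S′⊆S) f (λ i → cong g (τ-eq i))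
  ; F-resp-≈     = id
  ; identity     = lift λ _ → refl
  ; homomorphism = lift λ _ → refl
  }

FRgᴿ : ∀ {a} →
       ((T : Set a) → IsRegular (FRg T)) →
       (∀ {T T′ : Set a} (g : T → T′) → IsRegularFunctor (FRg₁ g)) →
       Set⟶RgCat a
FRgᴿ regular preserves = record
  { L₀ = λ T → record { category = FRg T ; isRegular = regular T }
  ; L₁ = λ g → record { functor = FRg₁ g ; isRegular = preserves g }
  }

{-# OPTIONS --safe #-}

-- Underlying functions of morphisms of FRg T point backwards, so a cone in FRg T is a limit iff
-- its legs are jointly surjective, identify no more than the diagram forces, and S of the apex
-- is covered by the sets of the diagram; and a regular epimorphism is an injection that keeps S.
-- Both conditions are visibly preserved by FRg g.  They are preserved by the counit
--   (n , S , τ) ↦ ∏ᵢ τ i × ∏ₛ supp s,   supp s the image of s → 1,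
-- because maps into this object are families of maps into the τ i, the supports being
-- subterminal, and because each omitted factor τ i → supp (τ i) is a regular epimorphism.
--
-- For the universal property let F, G be regular functors on FRg T with maps φ between their
-- values at the units (1 , {t} , t).  Since (n , S , τ) is the product of the units of the τ i
-- and the subterminal (0 , S), the images of its points under G are jointly monic, so a
-- transformation extending φ is unique, and natural as soon as it exists componentwise.  It
-- exists at products of units, and every object is a regular quotient of one.  All the natural
-- isomorphisms making up the adjunction are obtained from this extension property.
module Submission where

open import Defs
open import Level using (Level; _⊔_; Lift; lift; lower)
open import Data.Bool.Base using (Bool; true; false; if_then_else_; T)
open import Data.Fin.Base using (Fin; zero; suc; punchIn; punchOut; splitAt; _↑ˡ_; _↑ʳ_)
open import Data.Fin.Properties
  using (_≟_; any?; injective⇒≤; punchInᵢ≢i; punchOut-injective; punchOut-cong;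
         punchOut-punchIn; splitAt-↑ˡ; splitAt-↑ʳ; ↑ʳ-injective)
open import Data.List.Base
  using (List; []; _∷_; [_]; _++_; map; concatMap; allFin; cartesianProduct; filter; length; lookup)
open import Data.List.Membership.Propositional using (_∈_)
open import Data.List.Membership.Propositional.Properties
  using (∈-map⁺; ∈-map⁻; ∈-++⁺ˡ; ∈-++⁺ʳ; ∈-++⁻; ∈-concatMap⁺; ∈-concatMap⁻; ∈-cartesianProduct⁺;
         ∈-filter⁺; ∈-filter⁻; ∈-allFin; ∈-lookup)
open import Data.List.Relation.Binary.Subset.Propositional using (_⊆_)
import Data.List.Relation.Binary.Subset.Propositional.Properties as Subset
import Data.List.Relation.Unary.All as All
open import Data.List.Relation.Unary.AllPairs using (_∷_)
open import Data.List.Relation.Unary.Any as Any using (here; there)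
open import Data.List.Relation.Unary.Any.Properties using (lookup-index)
open import Data.List.Relation.Unary.Unique.Propositional using (Unique)
import Data.List.Relation.Unary.Unique.Propositional.Properties as Unique
open import Data.Nat.Base as ℕ using (ℕ; zero; suc)
import Data.Nat.Properties as ℕ
open import Data.Product using (Σ; ∃; ∃!; _×_; _,_; proj₁; proj₂)
open import Data.Sum.Base using (_⊎_; inj₁; inj₂)
open import Data.Unit.Base using (tt)
import Data.Vec.Functional as Vector
open import Data.Vec.Functional.Properties using (lookup-++ˡ; lookup-++ʳ)
import Data.Vec.Functional.Relation.Unary.All.Properties as VectorAll
open import Function.Base using (id) renaming (_∘_ to _⊙_)
open import Function.Definitions using (Injective)
open import Relation.Binary.Construct.Closure.Equivalence as Eq using (EqClosure)
open import Relation.Binary.Construct.Closure.ReflexiveTransitive using (_◅◅_)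
open import Relation.Binary.Core using (Rel)
import Relation.Binary.Definitions as Binary
open import Relation.Binary.PropositionalEquality as ≡ using (_≡_; _≢_; refl; sym; trans; cong; subst)
import Relation.Binary.Reasoning.Setoid as SetoidReasoning
open import Relation.Binary.Structures using (IsEquivalence)
open import Relation.Nullary using (Dec; yes; no; contradiction; ¬?)
open import Relation.Nullary.Decidable using (⌊_⌋; toWitness; fromWitness; decidable-stable)
open import Relation.Unary using (Pred; Decidable)

private variable
  a b r o ℓ e : Level

-- Quotients of finite sets

lookup-injective : {A : Set a} {xs : List A} → Unique xs → Injective _≡_ _≡_ (lookup xs)
lookup-injective (_ ∷ _)     {zero}  {zero}  _  = refl
lookup-injective (x∉ ∷ _)    {zero}  {suc j} eq = contradiction eq (All.lookup x∉ (∈-lookup j))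
lookup-injective (x∉ ∷ _)    {suc i} {zero}  eq = contradiction (sym eq) (All.lookup x∉ (∈-lookup i))
lookup-injective (_ ∷ xs!)   {suc i} {suc j} eq = cong suc (lookup-injective xs! eq)

record Enumeration {A : Set a} (P : Pred A b) : Set (a ⊔ b) where
  field
    size      : ℕ
    elem      : Fin size → A
    injective : Injective _≡_ _≡_ elem
    sound     : ∀ k → P (elem k)
    complete  : ∀ {x} → P x → ∃ λ k → elem k ≡ x

enumerate : ∀ {n} {P : Pred (Fin n) b} → Decidable P → Enumeration P
enumerate {n = n} P? = record
  { size      = length xs
  ; elem      = lookup xs
  ; injective = lookup-injective (Unique.filter⁺ P? (Unique.allFin⁺ n))
  ; sound     = λ k → proj₂ (∈-filter⁻ P? {xs = allFin n} (∈-lookup k))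
  ; complete  = λ {x} p → let x∈xs = ∈-filter⁺ P? (∈-allFin x) p
                          in Any.index x∈xs , sym (lookup-index x∈xs)
  }
  where xs = filter P? (allFin n)

-- `sound` and `complete` make the kernel of `class` the equivalence relation generated by `_∼_`.
-- The section `repr` lets functions out of the quotient be computed on representatives.
record Quotient {V : Set a} (_∼_ : Rel V r) : Set (a ⊔ r) where
  field
    size     : ℕ
    class    : V → Fin size
    repr     : Fin size → V
    class∘repr : ∀ k → class (repr k) ≡ k
    sound    : ∀ {x y} → x ∼ y → class x ≡ class y
    complete : ∀ {x y} → class x ≡ class y → EqClosure _∼_ x y

module _ {m : ℕ} {i j : Fin (suc m)} (i≢j : i ≢ j) where

  -- The point `i` is deleted and sent to the place that `j` keeps, so the quotient is again of the
  -- form `Fin m`.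
  merge : Fin (suc m) → Fin m
  merge x with i ≟ x
  ... | yes _  = punchOut i≢j
  ... | no i≢x = punchOut i≢x

  merge-identifies : merge i ≡ merge j
  merge-identifies with i ≟ i | i ≟ j
  ... | yes _  | yes i≡j = contradiction i≡j i≢j
  ... | yes _  | no _    = punchOut-cong i refl
  ... | no i≢i | _       = contradiction refl i≢i

  merge-punchIn : ∀ k → merge (punchIn i k) ≡ k
  merge-punchIn k with i ≟ punchIn i k
  ... | yes eq = contradiction (sym eq) (punchInᵢ≢i i k)
  ... | no _   = trans (punchOut-cong i refl) (punchOut-punchIn i)

  merge-reflects : ∀ x y → merge x ≡ merge y → (x ≡ y) ⊎ (x ≡ i × y ≡ j) ⊎ (x ≡ j × y ≡ i)
  merge-reflects x y eq with i ≟ x | i ≟ y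
  ... | yes refl | yes refl = inj₁ refl
  ... | yes refl | no i≢y   = inj₂ (inj₁ (refl , sym (punchOut-injective i≢j i≢y eq)))
  ... | no i≢x   | yes refl = inj₂ (inj₂ (punchOut-injective i≢x i≢j eq , refl))
  ... | no i≢x   | no i≢y   = inj₁ (punchOut-injective i≢x i≢y eq)

ListRel : {A : Set a} → List (A × A) → Rel A a
ListRel es x y = (x , y) ∈ es

-- Induction on the list: a pair whose ends already share a class changes nothing, and any other
-- pair merges two classes, lowering the size by one.
quotientFin : ∀ {n} (es : List (Fin n × Fin n)) → Quotient (ListRel es)
quotientFin {n} [] = record
  { size = n ; class = id ; repr = id ; class∘repr = λ _ → refl
  ; sound = λ () ; complete = λ { refl → Eq.reflexive _ } }
quotientFin {n} ((a , b) ∷ es) = extend (quotientFin es)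
  where
  weaken : ∀ {x y} → EqClosure (ListRel es) x y → EqClosure (ListRel ((a , b) ∷ es)) x y
  weaken = Eq.map there

  extend : Quotient (ListRel es) → Quotient (ListRel ((a , b) ∷ es))
  -- The element `a` has a class, so there is at least one class.
  extend record { size = zero ; class = class } with () ← class a
  extend Q@record { size = suc m ; class = class ; repr = repr } with class a ≟ class b
  ... | yes a≡b = record
    { Quotient Q
    ; sound    = λ { (here refl) → a≡b ; (there e) → Quotient.sound Q e }
    ; complete = weaken ⊙ Quotient.complete Q
    }
  ... | no a≢b = record
    { size       = m
    ; class      = merge a≢b ⊙ class
    -- The class of `a` is the deleted one; the merged class keeps the representative of the class
    -- of `b`.
    ; repr       = repr ⊙ punchIn (class a)
    ; class∘repr = λ k → trans (cong (merge a≢b) (Quotient.class∘repr Q _)) (merge-punchIn a≢b k)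
    ; sound      = λ { (here refl) → merge-identifies a≢b
                     ; (there e)   → cong (merge a≢b) (Quotient.sound Q e) }
    ; complete   = λ {x} {y} eq → connect (merge-reflects a≢b (class x) (class y) eq)
    }
    where
    a~b : EqClosure (ListRel ((a , b) ∷ es)) a b
    a~b = Eq.return (here refl)
    connect : ∀ {x y} →
              (class x ≡ class y) ⊎ (class x ≡ class a × class y ≡ class b) ⊎
              (class x ≡ class b × class y ≡ class a) →
              EqClosure (ListRel ((a , b) ∷ es)) x y
    connect (inj₁ eq) = weaken (Quotient.complete Q eq)
    connect (inj₂ (inj₁ (p , q))) =
      weaken (Quotient.complete Q p) ◅◅ a~b ◅◅ weaken (Quotient.complete Q (sym q))
    connect (inj₂ (inj₂ (p , q))) =
      weaken (Quotient.complete Q p) ◅◅ Eq.symmetric _ a~b ◅◅ weaken (Quotient.complete Q (sym q))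

-- Points are coded by their positions in the list, which reduces the problem to a relation on `Fin`
-- given by a list of pairs.
quotient : {V : Set a} {_∼_ : Rel V r} (points : List V) → (∀ v → v ∈ points) →
           Binary.Decidable _∼_ → Quotient _∼_
quotient {V = V} {_∼_ = _∼_} points all-points _∼?_ = record
  { size       = Q.size
  ; class      = Q.class ⊙ encode
  ; repr       = decode ⊙ Q.repr
  -- Encoding a decoded position may return another occurrence of the same point; the pair in
  -- `retractions` puts both into one class.
  ; class∘repr = λ k → trans (sym (Q.sound (∈-++⁺ˡ (∈-map⁺ retraction (∈-allFin _))))) (Q.class∘repr k)
  ; sound      = λ x∼y → Q.sound (∈-++⁺ʳ retractions
      (∈-map⁺ _ (∈-filter⁺ related? (∈-cartesianProduct⁺ (all-points _) (all-points _)) x∼y)))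
  ; complete   = λ eq → ≡.subst₂ (EqClosure _∼_) (decode-encode _) (decode-encode _)
                          (Eq.gfold (Eq.isEquivalence _∼_) decode decode-related (Q.complete eq))
  }
  where
  related? : Decidable λ (x , y) → x ∼ y
  related? (x , y) = x ∼? y
  decode : Fin (length points) → V
  decode = lookup points
  encode : V → Fin (length points)
  encode v = Any.index (all-points v)
  decode-encode : ∀ v → decode (encode v) ≡ v
  decode-encode v = sym (lookup-index (all-points v))
  retraction : Fin (length points) → Fin (length points) × Fin (length points)
  retraction k = k , encode (decode k)
  -- `points` may list a point several times; these pairs identify its occurrences.
  retractions codedPairs : List (Fin (length points) × Fin (length points))
  retractions = map retraction (allFin _)
  codedPairs  = map (λ xy → encode (proj₁ xy) , encode (proj₂ xy))
                    (filter related? (cartesianProduct points points))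
  module Q = Quotient (quotientFin (retractions ++ codedPairs))
  decode-related : ∀ {k l} → (k , l) ∈ retractions ++ codedPairs → EqClosure _∼_ (decode k) (decode l)
  decode-related e with ∈-++⁻ retractions e
  ... | inj₁ e₁ with _ , _ , refl ← ∈-map⁻ _ e₁ =
    ≡.subst (EqClosure _∼_ _) (sym (decode-encode _)) (Eq.reflexive _∼_)
  ... | inj₂ e₂ with _ , xy∈ , refl ← ∈-map⁻ _ e₂ =
    ≡.subst₂ (EqClosure _∼_) (sym (decode-encode _)) (sym (decode-encode _))
      (Eq.return (proj₂ (∈-filter⁻ related? {xs = cartesianProduct points points} xy∈)))

-- Finite preorders as index categories

module Preorder {n : ℕ} (_≤_ : Fin n → Fin n → Bool)
                (≤-refl : ∀ i → T (i ≤ i)) (≤-trans : ∀ i j k → T (i ≤ j) → T (j ≤ k) → T (i ≤ k)) where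

  private
    #arrows : Bool → ℕ
    #arrows b = if b then 1 else 0

    arrow : ∀ {b} → T b → Fin (#arrows b)
    arrow {true} _ = zero

    T-arrow : ∀ {b} → Fin (#arrows b) → T b
    T-arrow {true} _ = tt

    arrow-unique : ∀ {b} (u v : Fin (#arrows b)) → u ≡ v
    arrow-unique {true} zero zero = refl

  -- Each hom-set has one element or none, so all category laws are instances of `arrow-unique`.
  finiteCategory : FiniteCategory
  finiteCategory = record
    { #obj      = n
    ; #hom      = λ i j → #arrows (i ≤ j)
    ; idn       = λ {i} → arrow (≤-refl i)
    ; _∘_       = λ {i} {j} {k} g f → arrow (≤-trans i j k (T-arrow f) (T-arrow g))
    ; assoc     = arrow-unique _ _
    ; identityˡ = arrow-unique _ _
    ; identityʳ = arrow-unique _ _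
    }

  hom⇒≤ : ∀ {i j} → Category.Hom (FiniteCategory.category finiteCategory) i j → T (i ≤ j)
  hom⇒≤ = T-arrow

  hom-unique : ∀ {i j} (u v : Category.Hom (FiniteCategory.category finiteCategory) i j) → u ≡ v
  hom-unique = arrow-unique

module Discrete (n : ℕ) = Preorder {n} (λ i j → ⌊ i ≟ j ⌋) (λ i → fromWitness {a? = i ≟ i} refl)
  (λ i j k p q → fromWitness {a? = i ≟ k} (≡.trans (toWitness {a? = i ≟ j} p) (toWitness {a? = j ≟ k} q)))

discrete : ℕ → FiniteCategory
discrete = Discrete.finiteCategory

discrete-≡ : ∀ {n} {i j : Fin n} → Category.Hom (FiniteCategory.category (discrete n)) i j → i ≡ j
discrete-≡ {n} {i} {j} u = toWitness {a? = i ≟ j} (Discrete.hom⇒≤ n u)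

infix 4 _≤ᶜ_

-- The vertex zero is the foot of the cospan.
_≤ᶜ_ : Fin 3 → Fin 3 → Bool
_     ≤ᶜ zero  = true
zero  ≤ᶜ suc _ = false
suc i ≤ᶜ suc j = ⌊ i ≟ j ⌋

≤ᶜ-refl : ∀ i → T (i ≤ᶜ i)
≤ᶜ-refl zero    = tt
≤ᶜ-refl (suc i) = fromWitness {a? = i ≟ i} refl

≤ᶜ-trans : ∀ i j k → T (i ≤ᶜ j) → T (j ≤ᶜ k) → T (i ≤ᶜ k)
≤ᶜ-trans i       j       zero    p q = tt
≤ᶜ-trans (suc i) (suc j) (suc k) p q =
  fromWitness {a? = i ≟ k} (≡.trans (toWitness {a? = i ≟ j} p) (toWitness {a? = j ≟ k} q))

module Cospan = Preorder _≤ᶜ_ ≤ᶜ-refl ≤ᶜ-trans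

cospan : FiniteCategory
cospan = Cospan.finiteCategory

-- Regular epimorphisms and supports

module HomReasoning (C : Category o ℓ e) where
  open Category C

  module _ {A B : Obj} where
    open SetoidReasoning (hom-setoid A B) public

  infixr 4 _⟩∘⟨_ refl⟩∘⟨_
  infixl 5 _⟩∘⟨refl

  _⟩∘⟨_ : ∀ {A B X} {f f′ : Hom B X} {g g′ : Hom A B} → f ≈ f′ → g ≈ g′ → f ∘ g ≈ f′ ∘ g′
  _⟩∘⟨_ = ∘-resp-≈

  refl⟩∘⟨_ : ∀ {A B X} {f : Hom B X} {g g′ : Hom A B} → g ≈ g′ → f ∘ g ≈ f ∘ g′
  refl⟩∘⟨_ = ∘-resp-≈ Equiv.refl

  _⟩∘⟨refl : ∀ {A B X} {f f′ : Hom B X} {g : Hom A B} → f ≈ f′ → f ∘ g ≈ f′ ∘ g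
  p ⟩∘⟨refl = ∘-resp-≈ p Equiv.refl

  pullˡ : ∀ {A B X Y} {f : Hom X Y} {g : Hom B X} {h : Hom A B} {fg : Hom B Y} →
          f ∘ g ≈ fg → f ∘ (g ∘ h) ≈ fg ∘ h
  pullˡ p = Equiv.trans (Equiv.sym assoc) (p ⟩∘⟨refl)

  pullʳ : ∀ {A B X Y} {f : Hom X Y} {g : Hom B X} {h : Hom A B} {gh : Hom A X} →
          g ∘ h ≈ gh → (f ∘ g) ∘ h ≈ f ∘ gh
  pullʳ p = Equiv.trans assoc (refl⟩∘⟨ p)

module _ (C : Category o ℓ e) where
  open Category C
  open HomReasoning C

  IsProduct : ∀ {n P} (A : Fin n → Obj) → (∀ i → Hom P (A i)) → Set (o ⊔ ℓ ⊔ e)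
  IsProduct {P = P} A π =
    ∀ {X} (f : ∀ i → Hom X (A i)) → ∃! (_≈_ {X} {P}) λ u → ∀ i → π i ∘ u ≈ f i

  Product : ∀ {n} → (Fin n → Obj) → Set (o ⊔ ℓ ⊔ e)
  Product A = Σ Obj λ P → Σ (∀ i → Hom P (A i)) (IsProduct A)

  IsEpi : ∀ {A B} → Hom A B → Set (o ⊔ ℓ ⊔ e)
  IsEpi {A} {B} c = ∀ {X} {u v : Hom B X} → u ∘ c ≈ v ∘ c → u ≈ v

  -- Colours in `FRg Obj` are objects, so the equations `τ-eq` have to act as morphisms; discrete
  -- diagrams use the same action on their arrows.
  arr : ∀ {A B} → A ≡ B → Hom A B
  arr refl = idn

  arr-sym-cancel : ∀ {A B X} (p : A ≡ B) {x : Hom X A} {y : Hom X B} →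
                   arr p ∘ x ≈ y → arr (≡.sym p) ∘ y ≈ x
  arr-sym-cancel refl q = Equiv.trans identityˡ (Equiv.trans (Equiv.sym q) identityˡ)

  arr-trans : ∀ {A B D X} (p : A ≡ B) (q : B ≡ D) (x : Hom X A) →
              arr (≡.trans p q) ∘ x ≈ arr q ∘ arr p ∘ x
  arr-trans refl q x = refl⟩∘⟨ Equiv.sym identityˡ

  product-unique : ∀ {n P} {A : Fin n → Obj} {π : ∀ i → Hom P (A i)} → IsProduct A π →
                   ∀ {X} {u v : Hom X P} → (∀ i → π i ∘ u ≈ π i ∘ v) → u ≈ v
  product-unique {π = π} P! {v = v} eq with _ , _ , unique ← P! (λ i → π i ∘ v) =
    Equiv.trans (Equiv.sym (unique eq)) (unique λ _ → Equiv.refl)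

  discreteDiagram : ∀ {n} → (Fin n → Obj) → Functor (FiniteCategory.category (discrete n)) C
  discreteDiagram {n} A = record
    { F₀           = A
    ; F₁           = λ u → arr (cong A (discrete-≡ u))
    ; F-resp-≈     = λ { refl → Equiv.refl }
    ; identity     = λ {i} → arr-refl (cong A (discrete-≡ (FiniteCategory.idn (discrete n) {i})))
    ; homomorphism = λ {i} {j} {k} {u} {v} → arr-∘ (cong A (discrete-≡ u)) (cong A (discrete-≡ v))
                       (cong A (discrete-≡ (FiniteCategory._∘_ (discrete n) {i} {j} {k} v u)))
    }
    where
    arr-refl : ∀ {A} (p : A ≡ A) → arr p ≈ idn
    arr-refl refl = Equiv.refl
    arr-∘ : ∀ {A B D} (p : A ≡ B) (q : B ≡ D) (r : A ≡ D) → arr r ≈ arr q ∘ arr p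
    arr-∘ refl refl refl = Equiv.sym identityˡ

  discreteCone : ∀ {n} {D : Functor (FiniteCategory.category (discrete n)) C} {X} →
                 (∀ i → Hom X (Functor.F₀ D i)) → Cone D
  discreteCone {n} {D} {X} f = record { apex = X ; ψ = f ; commute = commute }
    where
    open Functor D
    commute : ∀ {j k} (u : Category.Hom (FiniteCategory.category (discrete n)) j k) → F₁ u ∘ f j ≈ f k
    commute u with refl ← discrete-≡ u = begin
      F₁ u ∘ f _                            ≈⟨ F-resp-≈ (Discrete.hom-unique n u (FiniteCategory.idn (discrete n))) ⟩∘⟨refl ⟩
      F₁ (FiniteCategory.idn (discrete n)) ∘ f _ ≈⟨ identity ⟩∘⟨refl ⟩
      idn ∘ f _                             ≈⟨ identityˡ ⟩
      f _                                   ∎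

  limit⇒product : ∀ {n} {D : Functor (FiniteCategory.category (discrete n)) C} {L : Cone D} →
                  IsLimit L → IsProduct (Functor.F₀ D) (Cone.ψ L)
  limit⇒product lim f = lim (discreteCone f)

  cospanDiagram : ∀ {A B Z} → Hom A Z → Hom B Z → Functor (FiniteCategory.category cospan) C
  cospanDiagram {A} {B} {Z} f g = record
    { F₀ = F₀ ; F₁ = λ {i} {j} → F₁ i j ; F-resp-≈ = λ { refl → Equiv.refl }
    ; identity = λ {i} → identity i
    ; homomorphism = λ {i} {j} {k} {u} {v} → homomorphism i j k u v }
    where
    module J = Category (FiniteCategory.category cospan)
    F₀ : Fin 3 → Obj
    F₀ zero             = Z
    F₀ (suc zero)       = A
    F₀ (suc (suc zero)) = B
    F₁ : ∀ i j → J.Hom i j → Hom (F₀ i) (F₀ j)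
    F₁ zero             zero             u = idn
    F₁ (suc zero)       zero             u = f
    F₁ (suc (suc zero)) zero             u = g
    F₁ (suc zero)       (suc zero)       u = idn
    F₁ (suc (suc zero)) (suc (suc zero)) u = idn
    identity : ∀ i → F₁ i i (J.idn {i}) ≈ idn
    identity zero             = Equiv.refl
    identity (suc zero)       = Equiv.refl
    identity (suc (suc zero)) = Equiv.refl
    homomorphism : ∀ i j k (u : J.Hom i j) (v : J.Hom j k) →
                   F₁ i k (J._∘_ {i} {j} {k} v u) ≈ F₁ j k v ∘ F₁ i j u
    homomorphism zero             zero             zero             u v = Equiv.sym identityʳ
    homomorphism (suc zero)       zero             zero             u v = Equiv.sym identityˡ
    homomorphism (suc (suc zero)) zero             zero             u v = Equiv.sym identityˡ
    homomorphism (suc zero)       (suc zero)       zero             u v = Equiv.sym identityʳ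
    homomorphism (suc (suc zero)) (suc (suc zero)) zero             u v = Equiv.sym identityʳ
    homomorphism (suc zero)       (suc zero)       (suc zero)       u v = Equiv.sym identityʳ
    homomorphism (suc (suc zero)) (suc (suc zero)) (suc (suc zero)) u v = Equiv.sym identityʳ

  module _ {A B Z} {f : Hom A Z} {g : Hom B Z} where

    cospanCone : ∀ {X} (h : Hom X A) (k : Hom X B) → f ∘ h ≈ g ∘ k → Cone (cospanDiagram f g)
    cospanCone {X} h k eq = record { apex = X ; ψ = ψ ; commute = λ {i} {j} → commute i j }
      where
      ψ : ∀ j → Hom X (Functor.F₀ (cospanDiagram f g) j)
      ψ zero             = f ∘ h
      ψ (suc zero)       = h
      ψ (suc (suc zero)) = k
      commute : ∀ i j (u : Category.Hom (FiniteCategory.category cospan) i j) →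
                Functor.F₁ (cospanDiagram f g) u ∘ ψ i ≈ ψ j
      commute zero             zero             u = identityˡ
      commute (suc zero)       zero             u = Equiv.refl
      commute (suc (suc zero)) zero             u = Equiv.sym eq
      commute (suc zero)       (suc zero)       u = identityˡ
      commute (suc (suc zero)) (suc (suc zero)) u = identityˡ

    limit⇒pullback : {L : Cone (cospanDiagram f g)} → IsLimit L →
                     IsPullback C (Cone.ψ L (suc zero)) (Cone.ψ L (suc (suc zero))) f g
    limit⇒pullback {L} lim = Equiv.trans fp (Equiv.sym (L.commute {suc (suc zero)} {zero} zero)) ,
      λ h k eq → let u , legs , unique = lim (cospanCone h k eq) in
        u , (legs (suc zero) , legs (suc (suc zero))) ,
        λ (ph , qk) → unique λ where
          zero             → Equiv.trans (Equiv.sym fp ⟩∘⟨refl) (pullʳ ph)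
          (suc zero)       → ph
          (suc (suc zero)) → qk
      where
      module L = Cone L
      fp : f ∘ L.ψ (suc zero) ≈ L.ψ zero
      fp = L.commute {suc zero} {zero} zero

  regularEpi⇒epi : ∀ {A B} {c : Hom A B} → IsRegularEpi C c → IsEpi c
  regularEpi⇒epi (_ , p , q , cp≈cq , factor) {u = u} {v} uc≈vc
    with _ , _ , unique ← factor (v ∘ _) (Equiv.trans (pullʳ cp≈cq) (Equiv.sym assoc)) =
    Equiv.trans (Equiv.sym (unique uc≈vc)) (unique Equiv.refl)

  -- A regular epimorphism is effective: h descends along c as soon as it is constant on
  -- the (generalised) fibres of c.
  descend : ∀ {A B} {c : Hom A B} → IsRegularEpi C c → ∀ {X} (h : Hom A X) →
            (∀ {Y} (x y : Hom Y A) → c ∘ x ≈ c ∘ y → h ∘ x ≈ h ∘ y) →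
            Σ (Hom B X) λ u → u ∘ c ≈ h
  descend (_ , p , q , cp≈cq , factor) h const with u , uc , _ ← factor h (const p q cp≈cq) = u , uc

  iso⇒regularEpi : ∀ {A B} {c : Hom A B} (d : Hom B A) → d ∘ c ≈ idn → c ∘ d ≈ idn → IsRegularEpi C c
  iso⇒regularEpi {c = c} d dc cd = _ , idn , idn , Equiv.refl , λ h _ →
    h ∘ d , Equiv.trans (pullʳ dc) identityʳ ,
    λ {v} vc → Equiv.trans (Equiv.sym vc ⟩∘⟨refl) (Equiv.trans (pullʳ cd) identityʳ)

-- Composites of regular epimorphisms, and supports, in a regular category

module RegularTheory (C : Category o ℓ e) (reg : IsRegular C) where
  open Category C
  open HomReasoning C
  open IsRegular reg

  abstract
    product : ∀ {n} (A : Fin n → Obj) → Product C A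
    product A with L , lim ← finiteLimit _ (discreteDiagram C A) =
      Cone.apex L , Cone.ψ L , limit⇒product C {L = L} lim

    pullback : ∀ {A B Z} (f : Hom A Z) (g : Hom B Z) →
               Σ Obj λ P → Σ (Hom P A) λ p → Σ (Hom P B) λ q → IsPullback C p q f g
    pullback f g with L , lim ← finiteLimit _ (cospanDiagram C f g) =
      Cone.apex L , Cone.ψ L (suc zero) , Cone.ψ L (suc (suc zero)) , limit⇒pullback C {L = L} lim

    -- This replaces the choice of preimages: the pullback of `c` along `y` carries the lift, and
    -- its projection to `Y` is epi by stability, so equations checked after it may be cancelled.
    localLift : ∀ {A B Y} {c : Hom A B} → IsRegularEpi C c → (y : Hom Y B) →
                Σ Obj λ Y′ → Σ (Hom Y′ Y) λ e → Σ (Hom Y′ A) λ y′ → IsEpi C e × c ∘ y′ ≈ y ∘ e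
    localLift {c = c} c-epi y with Y′ , y′ , e , pb@(comm , _) ← pullback c y =
      Y′ , e , y′ , regularEpi⇒epi C (regularEpiStable pb c-epi) , comm

  module _ {A B D} {c : Hom A B} {d : Hom B D} (c-epi : IsRegularEpi C c) (d-epi : IsRegularEpi C d) where

    private
      ConstantOnFibres : ∀ {X} → Hom A X → Set _
      ConstantOnFibres h = ∀ {Y} (x y : Hom Y A) → (d ∘ c) ∘ x ≈ (d ∘ c) ∘ y → h ∘ x ≈ h ∘ y

      -- Lift `x` locally along `c`, then `y` over the domain of that lift, so that both lifts can
      -- be compared on one object. There `constant` applies, and the two epimorphisms cancel.
      constant-descended : ∀ {X} {h : Hom A X} (u : Hom B X) → u ∘ c ≈ h → ConstantOnFibres h →
                           ∀ {Y} (x y : Hom Y B) → d ∘ x ≈ d ∘ y → u ∘ x ≈ u ∘ y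
      constant-descended {h = h} u uc constant x y dx≈dy
        with Y₁ , e₁ , x′ , e₁-epi , cx′ ← localLift c-epi x
        with Y₂ , e₂ , y′ , e₂-epi , cy′ ← localLift c-epi (y ∘ e₁) =
        e₁-epi (e₂-epi (begin
          ((u ∘ x) ∘ e₁) ∘ e₂  ≈⟨ pullʳ (Equiv.sym cx′) ⟩∘⟨refl ⟩
          (u ∘ c ∘ x′) ∘ e₂    ≈⟨ Equiv.trans (pullˡ uc ⟩∘⟨refl) assoc ⟩
          h ∘ x′ ∘ e₂          ≈⟨ constant (x′ ∘ e₂) y′ same ⟩
          h ∘ y′               ≈⟨ uc ⟩∘⟨refl ⟨
          (u ∘ c) ∘ y′         ≈⟨ pullʳ cy′ ⟩
          u ∘ (y ∘ e₁) ∘ e₂    ≈⟨ Equiv.trans (Equiv.sym assoc) (Equiv.sym assoc ⟩∘⟨refl) ⟩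
          ((u ∘ y) ∘ e₁) ∘ e₂  ∎))
        where
        same : (d ∘ c) ∘ x′ ∘ e₂ ≈ (d ∘ c) ∘ y′
        same = begin
          (d ∘ c) ∘ x′ ∘ e₂    ≈⟨ pullˡ (pullʳ cx′) ⟩
          (d ∘ x ∘ e₁) ∘ e₂    ≈⟨ pullˡ dx≈dy ⟩∘⟨refl ⟩
          ((d ∘ y) ∘ e₁) ∘ e₂  ≈⟨ Equiv.trans (assoc ⟩∘⟨refl) assoc ⟩
          d ∘ (y ∘ e₁) ∘ e₂    ≈⟨ refl⟩∘⟨ cy′ ⟨
          d ∘ c ∘ y′           ≈⟨ assoc ⟨
          (d ∘ c) ∘ y′         ∎

      descend-∘ : ∀ {X} (h : Hom A X) → ConstantOnFibres h → Σ (Hom D X) λ v → v ∘ d ∘ c ≈ h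
      descend-∘ h constant = proj₁ second , Equiv.trans (pullˡ (proj₂ second)) (proj₂ first)
        where
        first = descend C c-epi h λ x y eq → constant x y (Equiv.trans (pullʳ eq) (Equiv.sym assoc))
        second = descend C d-epi (proj₁ first) (constant-descended (proj₁ first) (proj₂ first) constant)

      epi-∘ : IsEpi C (d ∘ c)
      epi-∘ eq = regularEpi⇒epi C d-epi (regularEpi⇒epi C c-epi
        (Equiv.trans assoc (Equiv.trans eq (Equiv.sym assoc))))

      constantOnFibres : ∀ {K} {p q : Hom K A} → IsKernelPair C p q (d ∘ c) →
                         ∀ {X} (h : Hom A X) → h ∘ p ≈ h ∘ q → ConstantOnFibres h
      constantOnFibres {p = p} {q} (_ , lift!) h hp≈hq x y eq with z , (pz , qz) , _ ← lift! x y eq = begin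
        h ∘ x      ≈⟨ refl⟩∘⟨ pz ⟨
        h ∘ p ∘ z  ≈⟨ pullˡ hp≈hq ⟩
        (h ∘ q) ∘ z ≈⟨ pullʳ qz ⟩
        h ∘ y      ∎

    -- The composite is the coequalizer of its own kernel pair: a map equalizing that pair is
    -- constant on the fibres of `d ∘ c`, hence descends first along `c` and then along `d`.
    ∘-regularEpi : IsRegularEpi C (d ∘ c)
    ∘-regularEpi = coequalizer (pullback (d ∘ c) (d ∘ c))
      where
      coequalizer : (Σ Obj λ K → Σ (Hom K A) λ p → Σ (Hom K A) λ q → IsKernelPair C p q (d ∘ c)) →
                    IsRegularEpi C (d ∘ c)
      coequalizer (K , p , q , kp) = K , p , q , proj₁ kp , factor
        where
        factor : ∀ {X} (h : Hom A X) → h ∘ p ≈ h ∘ q → ∃! _≈_ λ v → v ∘ d ∘ c ≈ h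
        factor h hp≈hq = proj₁ v , proj₂ v , λ wdc → epi-∘ (Equiv.trans (proj₂ v) (Equiv.sym wdc))
          where v = descend-∘ h (constantOnFibres kp h hp≈hq)

  Subterminal : Obj → Set (o ⊔ ℓ ⊔ e)
  Subterminal U = ∀ {X} (x y : Hom X U) → x ≈ y

  abstract
    -- Local lifts of `x` and `y` along `c` become equal in `Z`, so they factor through the kernel
    -- pair of `f`, which `c` equalizes.
    kernelPairImage-subterminal :
      ∀ {A Z K U} {p q : Hom K A} {f : Hom A Z} {c : Hom A U} →
      (∀ {X} {x y : Hom X Z} → x ≈ y) → IsKernelPair C p q f → IsCoequalizer C p q c → Subterminal U
    kernelPairImage-subterminal {p = p} {q} {f} {c} Z-terminal (_ , lift!) coeq@(cp≈cq , _) x y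
      with Y₁ , e₁ , x′ , e₁-epi , cx′ ← localLift (_ , p , q , coeq) x
      with Y₂ , e₂ , y′ , e₂-epi , cy′ ← localLift (_ , p , q , coeq) (y ∘ e₁)
      with z , (pz , qz) , _ ← lift! (x′ ∘ e₂) y′ Z-terminal =
      e₁-epi (e₂-epi (begin
        (x ∘ e₁) ∘ e₂  ≈⟨ cx′ ⟩∘⟨refl ⟨
        (c ∘ x′) ∘ e₂  ≈⟨ assoc ⟩
        c ∘ x′ ∘ e₂    ≈⟨ refl⟩∘⟨ pz ⟨
        c ∘ p ∘ z      ≈⟨ pullˡ cp≈cq ⟩
        (c ∘ q) ∘ z    ≈⟨ pullʳ qz ⟩
        c ∘ y′         ≈⟨ cy′ ⟩
        (y ∘ e₁) ∘ e₂  ∎))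

    image : ∀ A → Σ Obj λ U → Σ (Hom A U) λ c → IsRegularEpi C c × Subterminal U
    image A =
      -- The empty product is the terminal object, and `t` is the map from `A` to it.
      let _ , _ , 1! = product {0} λ ()
          t , _      = 1! {A} λ ()
          K , p , q , kp = pullback t t
          U , c , coeq   = kernelPairCoequalizer kp
      in U , c , (K , p , q , coeq) ,
         kernelPairImage-subterminal {f = t} {c} (product-unique C 1! λ ()) kp coeq

  supp : Obj → Obj
  supp A = proj₁ (image A)

  cover : ∀ A → Hom A (supp A)
  cover A = proj₁ (proj₂ (image A))

  cover-regularEpi : ∀ A → IsRegularEpi C (cover A)
  cover-regularEpi A = proj₁ (proj₂ (proj₂ (image A)))

  supp-subterminal : ∀ A → Subterminal (supp A)
  supp-subterminal A = proj₂ (proj₂ (proj₂ (image A)))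

open Context
open _⇒_

-- Limits in FRg T as colimits of finite sets

module _ {T : Set a} {J : FiniteCategory} (E : Functor (FiniteCategory.category J) (FRg T)) where
  open Category (FRg T) using () renaming (idn to idnᶠ; _∘_ to _∘ᶠ_)
  private
    module J = FiniteCategory J
    module E = Functor E

  -- Nodes and steps form the category of elements of the underlying diagram of finite sets, in
  -- which arrows point backwards. The colimit of that diagram is the set of its connected
  -- components.
  Node : Set
  Node = Σ (Fin J.#obj) λ j → Fin (n (E.F₀ j))

  Step : Node → Node → Set
  Step (k , x) (j , y) = Σ (Fin (J.#hom j k)) λ u → fun (E.F₁ u) x ≡ y

  colour : Node → T
  colour (j , x) = τ (E.F₀ j) x

  step-colour : ∀ {v w} → Step v w → colour v ≡ colour w
  step-colour (u , refl) = sym (τ-eq (E.F₁ u) _)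

  leg : (L : Cone E) → Node → Fin (n (Cone.apex L))
  leg L (j , x) = fun (Cone.ψ L j) x

  leg-step : ∀ (L : Cone E) {v w} → Step v w → leg L v ≡ leg L w
  leg-step L (u , refl) = sym (lower (Cone.commute L u) _)

  leg-colour : ∀ (L : Cone E) v → τ (Cone.apex L) (leg L v) ≡ colour v
  leg-colour L (j , x) = τ-eq (Cone.ψ L j) x

  -- The first two fields say that the points of the apex are the connected components. The third
  -- bounds `S` of the apex by the union of the sets of the diagram; the legs supply the reverse
  -- inclusion.
  record IsColimiting (L : Cone E) : Set a where
    field
      surjective : ∀ x → ∃ λ v → leg L v ≡ x
      connected  : ∀ {v w} → leg L v ≡ leg L w → EqClosure Step v w
      supported  : ∀ {s} → s ∈ S (Cone.apex L) → ∃ λ j → s ∈ S (E.F₀ j)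

  private
    nodes : List Node
    nodes = concatMap (λ j → map (j ,_) (allFin _)) (allFin J.#obj)

    ∈-nodes : ∀ v → v ∈ nodes
    ∈-nodes (j , x) = ∈-concatMap⁺ _ (Any.map (λ { refl → ∈-map⁺ _ (∈-allFin x) }) (∈-allFin j))

    step? : Binary.Decidable Step
    step? (k , x) (j , y) = any? λ u → fun (E.F₁ u) x ≟ y

  colimitingCone : ∃ IsColimiting
  colimitingCone = cone , record
    { surjective = λ k → Q.repr k , Q.class∘repr k
    ; connected  = Q.complete
    ; supported  = λ s∈ → Any.satisfied (∈-concatMap⁻ (λ j → S (E.F₀ j)) {xs = allFin J.#obj} s∈)
    }
    where
    module Q = Quotient (quotient nodes ∈-nodes step?)

    S∈ : ∀ j → S (E.F₀ j) ⊆ concatMap (λ j → S (E.F₀ j)) (allFin J.#obj)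
    S∈ j s∈ = ∈-concatMap⁺ _ (Any.map (λ { refl → s∈ }) (∈-allFin j))

    cone : Cone E
    cone = record
      { apex = ctx Q.size (concatMap (λ j → S (E.F₀ j)) (allFin J.#obj)) (colour ⊙ Q.repr)
                   (λ k → S∈ (proj₁ (Q.repr k)) (τ∈S (E.F₀ (proj₁ (Q.repr k))) (proj₂ (Q.repr k))))
      ; ψ = λ j → mk⇒ (S∈ j) (λ x → Q.class (j , x)) λ x →
              -- Steps preserve colours, so the representative of a class has the colour of every
              -- node in it.
              Eq.gfold ≡.isEquivalence colour step-colour (Q.complete (Q.class∘repr (Q.class (j , x))))
      ; commute = λ u → lift λ x → sym (Q.sound (u , refl))
      }

  module _ {L : Cone E} (colim : IsColimiting L) where
    open IsColimiting colim

    -- The mediator sends a point to the leg of `K` at a chosen node above it; by `connected` any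
    -- other node above it gives the same value.
    colimiting⇒limit : IsLimit L
    colimiting⇒limit K = mediator , (λ j → lift λ x → leg-K (proj₂ (surjective _))) ,
      λ {u} eq → lift λ x → let (j , y) , p = surjective x in
        trans (sym (lower (eq j) y)) (cong (fun u) p)
      where
      leg-K : ∀ {v w} → leg L v ≡ leg L w → leg K v ≡ leg K w
      leg-K p = Eq.gfold ≡.isEquivalence (leg K) (leg-step K) (connected p)

      mediator : Cone.apex K ⇒ Cone.apex L
      mediator = mk⇒
        (λ s∈ → let j , s∈Sj = supported s∈ in S′⊆S (Cone.ψ K j) s∈Sj)
        (λ x → leg K (proj₁ (surjective x)))
        (λ x → let v , p = surjective x in
          trans (leg-colour K v) (trans (sym (leg-colour L v)) (cong (τ (Cone.apex L)) p)))

  -- Limits are unique up to isomorphism, so the conditions are transported to `L` from the explicit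
  -- cone `L₀` along the comparison maps `v` and `w`.
  limit⇒colimiting : {L : Cone E} → IsLimit L → IsColimiting L
  limit⇒colimiting {L} lim
    with L₀ , colim ← colimitingCone
    with v , vψ , _ ← lim L₀
    with w , wψ , _ ← colimiting⇒limit colim L
    with i , iψ , unique ← lim L = record
    { surjective = λ x → let y , p = surjective (fun v x) in y , (begin
        leg L y              ≡⟨ wψ′ y ⟨
        fun w (leg L₀ y)     ≡⟨ cong (fun w) p ⟩
        -- Both `v ∘ᶠ w` and the identity preserve the legs of `L`, so both agree with the mediator
        -- `i` from `L` to itself.
        fun w (fun v x)      ≡⟨ lower (unique {v ∘ᶠ w} vwψ) x ⟨
        fun i x              ≡⟨ lower (unique {idnᶠ} (λ j → lift λ _ → refl)) x ⟩
        x                    ∎)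
    ; connected  = λ {y} {z} p → connected (trans (sym (vψ′ y)) (trans (cong (fun v) p) (vψ′ z)))
    ; supported  = λ s∈ → supported (S′⊆S v s∈)
    }
    where
    open IsColimiting colim
    open ≡.≡-Reasoning
    vψ′ : ∀ y → fun v (leg L y) ≡ leg L₀ y
    vψ′ (j , x) = lower (vψ j) x
    wψ′ : ∀ y → fun w (leg L₀ y) ≡ leg L y
    wψ′ (j , x) = lower (wψ j) x
    vwψ : ∀ j → Lift _ (∀ x → fun w (fun v (fun (Cone.ψ L j) x)) ≡ fun (Cone.ψ L j) x)
    vwψ j = lift λ x → trans (cong (fun w) (vψ′ (j , x))) (wψ′ (j , x))

-- `FRg₁ g` leaves all underlying functions alone, hence also nodes, steps and legs; only the
-- condition on `S` has to be moved along `g`.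
FRg₁-colimiting : ∀ {T T′ : Set a} (g : T → T′) {J : FiniteCategory}
                  {E : Functor (FiniteCategory.category J) (FRg T)} {L : Cone E} →
                  IsColimiting E L → IsColimiting (FRg₁ g ∘F E) (mapCone (FRg₁ g) L)
FRg₁-colimiting g {E = E} colim = record
  { surjective = surjective
  ; connected  = connected
  ; supported  = λ s∈ → let s , s∈S , eq = ∈-map⁻ g s∈
                            j , s∈Sj = supported s∈S
                        in j , subst (_∈ map g (S (Functor.F₀ E j))) (sym eq) (∈-map⁺ g s∈Sj)
  }
  where open IsColimiting colim

-- Regular epimorphisms of `FRg T` as covers, and regularity

module _ {T : Set a} where
  open Category (FRg T) using () renaming (_∘_ to _∘ᶠ_)

  record IsCover {Γ Δ : Context T} (c : Γ ⇒ Δ) : Set a where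
    constructor _,_
    field
      injective : Injective _≡_ _≡_ (fun c)
      S⊆        : S Γ ⊆ S Δ

  restrict : (Γ : Context T) {m : ℕ} → (Fin m → Fin (n Γ)) → Context T
  restrict Γ f = ctx _ (S Γ) (τ Γ ⊙ f) (τ∈S Γ ⊙ f)

  adjoin : (Γ : Context T) {m : ℕ} (σ : Fin m → T) → (∀ i → σ i ∈ S Γ) → Context T
  adjoin Γ {m} σ σ∈S = ctx (m ℕ.+ n Γ) (S Γ) (σ Vector.++ τ Γ)
    (VectorAll.++⁺ (_∈ S Γ) {xs = σ} {ys = τ Γ} σ∈S (τ∈S Γ))

  module _ (Γ : Context T) {m : ℕ} (σ : Fin m → T) (σ∈S : ∀ i → σ i ∈ S Γ) where

    forget : adjoin Γ σ σ∈S ⇒ Γ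
    forget = mk⇒ id (m ↑ʳ_) (lookup-++ʳ σ (τ Γ))

    forget-isCover : IsCover forget
    forget-isCover = ↑ʳ-injective m _ _ , id

  new≢old : ∀ {m k} {i : Fin m} {j : Fin k} → m ↑ʳ j ≢ i ↑ˡ k
  new≢old {m} {k} {i} {j} eq
    with () ← trans (sym (splitAt-↑ʳ m k j)) (trans (cong (splitAt m) eq) (splitAt-↑ˡ m i k))

  -- On underlying finite sets a coequalizer is an equalizer: the hypotheses say that `fun c` is
  -- injective with image the set where `fun p` and `fun q` agree, so `fun h` factors through it.
  coequalizer-criterion :
    ∀ {K Γ Δ : Context T} {p q : K ⇒ Γ} {c : Γ ⇒ Δ} → IsCover c →
    (∀ k → fun p (fun c k) ≡ fun q (fun c k)) →
    (∀ x → fun p x ≡ fun q x → ∃ λ k → fun c k ≡ x) →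
    IsCoequalizer (FRg T) p q c
  coequalizer-criterion {Γ = Γ} {c = c} (injective , S⊆) equalized preimage =
    lift equalized , λ h hp≈hq → let pre = λ x → preimage (fun h x) (lower hp≈hq x) in
      mk⇒ (S⊆ ⊙ S′⊆S h) (proj₁ ⊙ pre)
          (λ x → trans (sym (τ-eq c _)) (trans (cong (τ Γ) (proj₂ (pre x))) (τ-eq h x))) ,
      lift (proj₂ ⊙ pre) ,
      λ vc≈h → lift λ x → injective (trans (proj₂ (pre x)) (sym (lower vc≈h x)))

  coequalizer : ∀ {K Γ : Context T} (p q : K ⇒ Γ) →
                ∃ λ Δ → Σ (Γ ⇒ Δ) λ c → IsCoequalizer (FRg T) p q c × IsCover c
  coequalizer {K} {Γ} p q = restrict Γ elem , c ,
    coequalizer-criterion {p = p} {q} {c} c-cover sound (λ _ → complete) , c-cover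
    where
    open Enumeration (enumerate λ x → fun p x ≟ fun q x)
    c : Γ ⇒ restrict Γ elem
    c = mk⇒ id elem (λ _ → refl)
    c-cover : IsCover c
    c-cover = injective , id

  -- Two coequalizers of the same pair are isomorphic, so `c` inherits both conditions from the
  -- explicit coequalizer `c₀`.
  regularEpi⇒cover : ∀ {Γ Δ : Context T} {c : Γ ⇒ Δ} → IsRegularEpi (FRg T) c → IsCover c
  regularEpi⇒cover {Γ} {Δ} {c} c-epi@(K , p , q , cp≈cq , factor)
    with Δ₀ , c₀ , (c₀p≈c₀q , factor₀) , c₀-injective , S⊆ ← coequalizer p q
    with w , wc , _ ← factor c₀ c₀p≈c₀q
    with v , vc₀ , _ ← factor₀ c cp≈cq = injective , S′⊆S w ⊙ S⊆
    where
    vw≈id : ∀ x → fun w (fun v x) ≡ x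
    vw≈id = lower (regularEpi⇒epi (FRg T) {c = c} c-epi {u = v ∘ᶠ w} {v = Category.idn (FRg T)}
      (lift λ x → trans (lower wc (fun v x)) (lower vc₀ x)))
    injective : Injective _≡_ _≡_ (fun c)
    injective {x} {y} eq = trans (sym (vw≈id x)) (trans (cong (fun w) vx≡vy) (vw≈id y))
      where
      vx≡vy : fun v x ≡ fun v y
      vx≡vy = c₀-injective (trans (lower vc₀ x) (trans eq (sym (lower vc₀ y))))

  -- c is the coequalizer of the two inclusions of Γ into two copies of it glued along Δ.
  cover⇒regularEpi : ∀ {Γ Δ : Context T} {c : Γ ⇒ Δ} → IsCover c → IsRegularEpi (FRg T) c
  cover⇒regularEpi {Γ} {Δ} {c} c-cover@(injective , S⊆) =
    Γ+Γ , p , q , coequalizer-criterion {p = p} {q} {c} c-cover equalized preimage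
    where
    Γ+Γ : Context T
    Γ+Γ = adjoin Γ (τ Γ) (τ∈S Γ)

    InImage : Fin (n Γ) → Set
    InImage x = ∃ λ k → fun c k ≡ x

    inImage? : ∀ x → Dec (InImage x)
    inImage? x = any? λ k → fun c k ≟ x

    glue : ∀ x → Dec (InImage x) → Fin (n Γ+Γ)
    -- Points in the image of `c` go to the second copy, where `p` also sends them; all others go to
    -- the first copy, which `p` never meets.
    glue x (yes _) = n Γ ↑ʳ x
    glue x (no _)  = x ↑ˡ n Γ

    glue-τ : ∀ x (d : Dec (InImage x)) → τ Γ+Γ (glue x d) ≡ τ Γ x
    glue-τ x (yes _) = lookup-++ʳ (τ Γ) (τ Γ) x
    glue-τ x (no _)  = lookup-++ˡ (τ Γ) (τ Γ) x

    p q : Γ+Γ ⇒ Γ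
    p = forget Γ (τ Γ) (τ∈S Γ)
    q = mk⇒ id (λ x → glue x (inImage? x)) (λ x → glue-τ x (inImage? x))

    equalized : ∀ k → fun p (fun c k) ≡ fun q (fun c k)
    equalized k with inImage? (fun c k)
    ... | yes _   = refl
    ... | no ¬img = contradiction (k , refl) ¬img

    preimage : ∀ x → fun p x ≡ fun q x → InImage x
    preimage x eq with inImage? x
    ... | yes img = img
    ... | no _    = contradiction eq new≢old

  -- Injectivity of q is tested on the amalgam X of A and B over Z, which maps to the pullback.
  cover-stable : ∀ {P A B Z : Context T} {p : P ⇒ A} {q : P ⇒ B} {f : A ⇒ Z} {g : B ⇒ Z} →
                 IsPullback (FRg T) p q f g → IsCover f → IsCover q
  cover-stable {P} {A} {B} {Z} {p} {q} {f} {g} (_ , lift!) (injective , S⊆) =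
      let u , (_ , qu) , _ = lift! h k (lift fh≡gk) in
      -- The function of `k` factors as that of `q` followed by that of `u`, and it is injective
      -- because `X` contains a copy of `B`.
      (λ eq → ↑ʳ-injective (n A) _ _ (trans (sym (lower qu _)) (trans (cong (fun u) eq) (lower qu _)))) ,
      S′⊆S u
    where
    A⊆B : S A ⊆ S B
    A⊆B s∈ = S′⊆S g (S⊆ s∈)

    X : Context T
    X = adjoin B (τ A) (A⊆B ⊙ τ∈S A)

    InImage : Fin (n A) → Set
    InImage x = ∃ λ z → fun f z ≡ x

    inImage? : ∀ x → Dec (InImage x)
    inImage? x = any? λ z → fun f z ≟ x

    glue : ∀ x → Dec (InImage x) → Fin (n X)
    -- The amalgamation: a point `fun f z` of `A` is identified with the point `fun g z` of `B`.
    glue x (yes (z , _)) = n A ↑ʳ fun g z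
    glue x (no _)        = x ↑ˡ n B

    glue-τ : ∀ x (d : Dec (InImage x)) → τ X (glue x d) ≡ τ A x
    glue-τ _ (yes (z , refl)) = trans (lookup-++ʳ (τ A) (τ B) (fun g z)) (trans (τ-eq g z) (sym (τ-eq f z)))
    glue-τ x (no _)           = lookup-++ˡ (τ A) (τ B) x

    h : X ⇒ A
    h = mk⇒ A⊆B (λ x → glue x (inImage? x)) (λ x → glue-τ x (inImage? x))

    k : X ⇒ B
    k = forget B (τ A) (A⊆B ⊙ τ∈S A)

    fh≡gk : ∀ z → fun h (fun f z) ≡ n A ↑ʳ fun g z
    fh≡gk z with inImage? (fun f z)
    -- Injectivity of `f` makes the preimage found by the search equal to `z`.
    ... | yes (z′ , eq) = cong (λ z → n A ↑ʳ fun g z) (injective eq)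
    ... | no ¬img       = contradiction (z , refl) ¬img

  FRg-isRegular : IsRegular (FRg T)
  FRg-isRegular = record
    { finiteLimit = λ J E → let L , colim = colimitingCone E in L , colimiting⇒limit E colim
    ; kernelPairCoequalizer = λ {_} {_} {_} {p} {q} _ → let Δ , c , coeq , _ = coequalizer p q in Δ , c , coeq
    ; regularEpiStable = λ {_} {_} {_} {_} {p} {q} {f} {g} pb f-epi →
        cover⇒regularEpi (cover-stable {p = p} {q} {f} {g} pb (regularEpi⇒cover f-epi))
    }

FRg₁-isRegular : ∀ {T T′ : Set a} (g : T → T′) → IsRegularFunctor (FRg₁ g)
FRg₁-isRegular g = record
  { preservesFiniteLimits = λ J {E} L lim →
      colimiting⇒limit (FRg₁ g ∘F E) (FRg₁-colimiting g {L = L} (limit⇒colimiting E {L = L} lim))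
  ; preservesRegularEpis = λ {_} {_} {c} c-epi →
      let injective , S⊆ = regularEpi⇒cover {c = c} c-epi in
      cover⇒regularEpi {c = Functor.F₁ (FRg₁ g) c} (injective , Subset.map⁺ g S⊆)
  }

-- Extension of isomorphisms from the units

module _ {T : Set a} where

  unit : T → Context T
  unit t = ctx 1 [ t ] (λ _ → t) (λ _ → here refl)

  point : (Γ : Context T) (x : Fin (n Γ)) → Γ ⇒ unit (τ Γ x)
  point Γ x = mk⇒ (λ { (here refl) → τ∈S Γ x }) (λ _ → x) (λ _ → refl)

  support : Context T → Context T
  support Γ = ctx 0 (S Γ) (λ ()) (λ ())

  toSupport : (Γ : Context T) → Γ ⇒ support Γ
  toSupport Γ = mk⇒ id (λ ()) (λ ())

  -- Its τ enumerates S Γ, which makes it a product of units.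
  resolution : Context T → Context T
  resolution Γ = adjoin Γ (lookup (S Γ)) ∈-lookup

  module _ (C : Category o ℓ e) (G : Functor (FRg T) C) (G-reg : IsRegularFunctor G) where
    open Category C
    open HomReasoning C
    open IsRegularFunctor G-reg
    private
      module G = Functor G

    preservesProduct : ∀ {k} {A : Fin k → Context T} {Γ} {legs : ∀ i → Γ ⇒ A i} →
                       IsColimiting (discreteDiagram (FRg T) A) (discreteCone (FRg T) legs) →
                       IsProduct C (λ i → G.F₀ (A i)) (λ i → G.F₁ (legs i))
    preservesProduct {k} {A} {Γ} {legs} colim =
      limit⇒product C {L = mapCone G (discreteCone (FRg T) legs)}
        (preservesFiniteLimits (discrete k) (discreteCone (FRg T) legs)
          (colimiting⇒limit (discreteDiagram (FRg T) A) {L = discreteCone (FRg T) legs} colim))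

    module _ (Γ : Context T) where

      -- A context without points is its own square, with both projections the identity. The functor
      -- `G` preserves this product, so the pair of `u` and `v` factors through a diagonal.
      support-subterminal : ∀ {X} (u v : Hom X (G.F₀ (support Γ))) → u ≈ v
      support-subterminal u v
        with w , legs , _ ← preservesProduct {A = λ (_ : Fin 2) → support Γ} {legs = λ _ → Category.idn (FRg T)}
          (record { surjective = λ () ; connected = λ { {_ , ()} } ; supported = λ s∈ → zero , s∈ })
          (λ { zero → u ; (suc zero) → v })
        = Equiv.trans (Equiv.sym (legs zero)) (legs (suc zero))

      points-jointlyMonic : ∀ {X} {u v : Hom X (G.F₀ Γ)} →
                            (∀ x → G.F₁ (point Γ x) ∘ u ≈ G.F₁ (point Γ x) ∘ v) → u ≈ v
      points-jointlyMonic {u = u} {v} eq = product-unique C (preservesProduct {A = A} {legs = legs}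
          (record { surjective = λ x → (suc x , zero) , refl ; connected = connected
                  ; supported = λ s∈ → zero , s∈ }))
          λ { zero → support-subterminal _ _ ; (suc x) → eq x }
        where
        A : Fin (suc (n Γ)) → Context T
        -- This factor accounts for the elements of `S Γ` that are not colours of points.
        A zero    = support Γ
        A (suc x) = unit (τ Γ x)
        legs : ∀ i → Γ ⇒ A i
        legs zero    = toSupport Γ
        legs (suc x) = point Γ x
        D = discreteDiagram (FRg T) A
        connected : ∀ {v w} → leg D (discreteCone (FRg T) legs) v ≡ leg D (discreteCone (FRg T) legs) w →
                    EqClosure (Step D) v w
        connected {suc x , zero} {suc y , zero} refl = Eq.reflexive _

      resolution-product : IsProduct C (λ x → G.F₀ (unit (τ (resolution Γ) x)))
                                       (λ x → G.F₁ (point (resolution Γ) x))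
      resolution-product = preservesProduct {legs = point (resolution Γ)} (record
        { surjective = λ x → (x , zero) , refl
        ; connected  = λ { {_ , zero} {_ , zero} refl → Eq.reflexive _ }
        -- An element of `S Γ` is the colour of the adjoined point at its position in the list.
        ; supported  = λ s∈ → Any.index s∈ ↑ˡ n Γ ,
            here (trans (lookup-index s∈) (sym (lookup-++ˡ (lookup (S Γ)) (τ Γ) (Any.index s∈))))
        })

    resolution-regularEpi : ∀ Γ → IsRegularEpi C (G.F₁ (forget Γ (lookup (S Γ)) ∈-lookup))
    resolution-regularEpi Γ = preservesRegularEpis
      (cover⇒regularEpi {c = forget Γ (lookup (S Γ)) ∈-lookup} (forget-isCover Γ (lookup (S Γ)) ∈-lookup))

  module Extend (C : Category o ℓ e)
                (F : Functor (FRg T) C) (F-reg : IsRegularFunctor F)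
                (G : Functor (FRg T) C) (G-reg : IsRegularFunctor G) where
    open Category C
    open HomReasoning C
    private
      module F = Functor F
      module G = Functor G

    module _ (φ : ∀ t → Hom (F.F₀ (unit t)) (G.F₀ (unit t))) where

      -- Naturality against morphisms into units only. Joint monicity of points makes it determine
      -- `α` and imply naturality in general.
      Compatible : ∀ {Γ} → Hom (F.F₀ Γ) (G.F₀ Γ) → Set _
      Compatible {Γ} α = ∀ {t} (g : Γ ⇒ unit t) → G.F₁ g ∘ α ≈ φ t ∘ F.F₁ g

      compatible-unique : ∀ {Γ} {α β : Hom (F.F₀ Γ) (G.F₀ Γ)} → Compatible α → Compatible β → α ≈ β
      compatible-unique {Γ} αc βc = points-jointlyMonic C G G-reg Γ λ x →
        Equiv.trans (αc (point Γ x)) (Equiv.sym (βc (point Γ x)))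

      -- Every morphism to a unit is a point, up to the identification of its colour.
      points⇒compatible : ∀ {Γ} {α : Hom (F.F₀ Γ) (G.F₀ Γ)} →
                          (∀ x → G.F₁ (point Γ x) ∘ α ≈ φ (τ Γ x) ∘ F.F₁ (point Γ x)) → Compatible α
      points⇒compatible {Γ} {α} eq g = go g (τ-eq g zero) refl
        where
        go : ∀ {x t} (g : Γ ⇒ unit t) → τ Γ x ≡ t → fun g zero ≡ x → G.F₁ g ∘ α ≈ φ t ∘ F.F₁ g
        go {x} g refl p = begin
          G.F₁ g ∘ α                            ≈⟨ G.F-resp-≈ g≈point ⟩∘⟨refl ⟩
          G.F₁ (point Γ x) ∘ α                  ≈⟨ eq x ⟩
          φ (τ Γ x) ∘ F.F₁ (point Γ x)          ≈⟨ refl⟩∘⟨ F.F-resp-≈ g≈point ⟨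
          φ (τ Γ x) ∘ F.F₁ g                    ∎
          where
          g≈point : Category._≈_ (FRg T) g (point Γ x)
          g≈point = lift λ { zero → p }

      compatible-∘ : ∀ {Γ Δ} {α : Hom (F.F₀ Γ) (G.F₀ Γ)} → Compatible α →
                     (f : Δ ⇒ Γ) {t : T} (g : Γ ⇒ unit t) →
                     G.F₁ g ∘ α ∘ F.F₁ f ≈ φ t ∘ F.F₁ (Category._∘_ (FRg T) g f)
      compatible-∘ {α = α} αc f g = begin
        G.F₁ g ∘ α ∘ F.F₁ f      ≈⟨ pullˡ (αc g) ⟩
        (φ _ ∘ F.F₁ g) ∘ F.F₁ f  ≈⟨ pullʳ (Equiv.sym F.homomorphism) ⟩
        φ _ ∘ F.F₁ (Category._∘_ (FRg T) g f) ∎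

      ∘-compatible : ∀ {Γ Δ} {α : Hom (F.F₀ Γ) (G.F₀ Γ)} → Compatible α →
                     (f : Γ ⇒ Δ) {t : T} (g : Δ ⇒ unit t) →
                     G.F₁ g ∘ G.F₁ f ∘ α ≈ φ t ∘ F.F₁ (Category._∘_ (FRg T) g f)
      ∘-compatible {α = α} αc f g = Equiv.trans (pullˡ (Equiv.sym G.homomorphism)) (αc _)

      compatible⇒natural : ∀ {Γ Δ} {α : Hom (F.F₀ Γ) (G.F₀ Γ)} {β : Hom (F.F₀ Δ) (G.F₀ Δ)} →
                           Compatible α → Compatible β → (f : Γ ⇒ Δ) → β ∘ F.F₁ f ≈ G.F₁ f ∘ α
      compatible⇒natural {Δ = Δ} αc βc f = points-jointlyMonic C G G-reg Δ λ x →
        Equiv.trans (compatible-∘ βc f (point Δ x)) (Equiv.sym (∘-compatible αc f (point Δ x)))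

      abstract
        -- At `resolution Γ`, a product of units, the component `α̃` is given by `φ` factor by
        -- factor. It then descends along the regular epimorphism `F.F₁ c`.
        component : ∀ Γ → Σ (Hom (F.F₀ Γ) (G.F₀ Γ)) λ α → Compatible α
        component Γ = α , λ g → regularEpi⇒epi C Fc-epi (begin
          (G.F₁ g ∘ α) ∘ F.F₁ c    ≈⟨ pullʳ αc ⟩
          G.F₁ g ∘ G.F₁ c ∘ α̃      ≈⟨ ∘-compatible α̃-compatible c g ⟩
          φ _ ∘ F.F₁ (Category._∘_ (FRg T) g c) ≈⟨ refl⟩∘⟨ F.homomorphism ⟩
          φ _ ∘ F.F₁ g ∘ F.F₁ c    ≈⟨ assoc ⟨
          (φ _ ∘ F.F₁ g) ∘ F.F₁ c  ∎)
          where
          c : resolution Γ ⇒ Γ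
          c = forget Γ (lookup (S Γ)) ∈-lookup
          Fc-epi : IsRegularEpi C (F.F₁ c)
          Fc-epi = resolution-regularEpi C F F-reg Γ
          mediator : ∃! _≈_ λ α → ∀ x → G.F₁ (point (resolution Γ) x) ∘ α ≈ φ _ ∘ F.F₁ (point (resolution Γ) x)
          mediator = resolution-product C G G-reg Γ λ x → φ _ ∘ F.F₁ (point (resolution Γ) x)
          α̃ : Hom (F.F₀ (resolution Γ)) (G.F₀ (resolution Γ))
          α̃ = proj₁ mediator
          α̃-compatible : Compatible α̃
          α̃-compatible = points⇒compatible (proj₁ (proj₂ mediator))
          constant : ∀ {X} (x y : Hom X (F.F₀ (resolution Γ))) → F.F₁ c ∘ x ≈ F.F₁ c ∘ y →
                     (G.F₁ c ∘ α̃) ∘ x ≈ (G.F₁ c ∘ α̃) ∘ y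
          -- Seen through a point of `Γ`, the map `G.F₁ c ∘ α̃` factors through `F.F₁ c` by
          -- compatibility.
          constant x y eq = points-jointlyMonic C G G-reg Γ λ k →
            Equiv.trans (via x k) (Equiv.trans (refl⟩∘⟨ eq) (Equiv.sym (via y k)))
            where
            via : ∀ {X} (x : Hom X (F.F₀ (resolution Γ))) k →
                  G.F₁ (point Γ k) ∘ (G.F₁ c ∘ α̃) ∘ x ≈ (φ _ ∘ F.F₁ (point Γ k)) ∘ F.F₁ c ∘ x
            via x k = begin
              G.F₁ (point Γ k) ∘ (G.F₁ c ∘ α̃) ∘ x  ≈⟨ pullˡ (∘-compatible α̃-compatible c (point Γ k)) ⟩
              (φ _ ∘ F.F₁ (Category._∘_ (FRg T) (point Γ k) c)) ∘ x ≈⟨ (refl⟩∘⟨ F.homomorphism) ⟩∘⟨refl ⟩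
              (φ _ ∘ F.F₁ (point Γ k) ∘ F.F₁ c) ∘ x ≈⟨ Equiv.trans (Equiv.sym assoc ⟩∘⟨refl) assoc ⟩
              (φ _ ∘ F.F₁ (point Γ k)) ∘ F.F₁ c ∘ x ∎
          descended : Σ (Hom (F.F₀ Γ) (G.F₀ Γ)) λ u → u ∘ F.F₁ c ≈ G.F₁ c ∘ α̃
          descended = descend C Fc-epi (G.F₁ c ∘ α̃) constant
          α : Hom (F.F₀ Γ) (G.F₀ Γ)
          α = proj₁ descended
          αc : α ∘ F.F₁ c ≈ G.F₁ c ∘ α̃
          αc = proj₂ descended

module _ {T : Set a} (C : Category o ℓ e)
         (F : Functor (FRg T) C) (F-reg : IsRegularFunctor F)
         (G : Functor (FRg T) C) (G-reg : IsRegularFunctor G) where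
  open Category C
  open HomReasoning C
  private
    module F = Functor F
    module G = Functor G

  compatible-inverse :
    ∀ (φ : ∀ t → Hom (F.F₀ (unit t)) (G.F₀ (unit t))) (ψ : ∀ t → Hom (G.F₀ (unit t)) (F.F₀ (unit t))) →
    (∀ t → ψ t ∘ φ t ≈ idn) →
    ∀ {Γ} {α : Hom (F.F₀ Γ) (G.F₀ Γ)} {β : Hom (G.F₀ Γ) (F.F₀ Γ)} →
    Extend.Compatible C F F-reg G G-reg φ α → Extend.Compatible C G G-reg F F-reg ψ β → β ∘ α ≈ idn
  compatible-inverse φ ψ ψφ {Γ} {α} {β} αc βc = points-jointlyMonic C F F-reg Γ λ x → begin
    F.F₁ (point Γ x) ∘ β ∘ α        ≈⟨ pullˡ (βc (point Γ x)) ⟩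
    (ψ _ ∘ G.F₁ (point Γ x)) ∘ α    ≈⟨ pullʳ (αc (point Γ x)) ⟩
    ψ _ ∘ φ _ ∘ F.F₁ (point Γ x)    ≈⟨ pullˡ (ψφ _) ⟩
    idn ∘ F.F₁ (point Γ x)          ≈⟨ identityˡ ⟩
    F.F₁ (point Γ x)                ≈⟨ identityʳ ⟨
    F.F₁ (point Γ x) ∘ idn          ∎

module _ {T : Set a} (C : Category o ℓ e)
         (F : Functor (FRg T) C) (F-reg : IsRegularFunctor F)
         (G : Functor (FRg T) C) (G-reg : IsRegularFunctor G) where
  open Category C
  open HomReasoning C
  private
    module F = Functor F
    module G = Functor G

  -- The inverses `from` extend in the same way, and both composites are identities because they are
  -- so when seen through points.
  extendIso : (φ : ∀ t → Iso C (F.F₀ (unit t)) (G.F₀ (unit t))) →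
              ∃! {A = F ≃ G} (λ α β → ∀ Γ → _≃_.to α Γ ≈ _≃_.to β Γ)
                 (λ α → ∀ t → _≃_.to α (unit t) ≈ Iso.to (φ t))
  extendIso φ = extension , extends , λ {β} β-extends Γ →
      compatible-unique to (α-compatible Γ) (natural⇒compatible β β-extends)
    where
    open Extend C F F-reg G G-reg
    to   = λ t → Iso.to (φ t)
    from = λ t → Iso.from (φ t)
    module Inverse = Extend C G G-reg F F-reg
    α-compatible : ∀ Γ → Compatible to (proj₁ (component to Γ))
    α-compatible Γ = proj₂ (component to Γ)
    β-compatible : ∀ Γ → Inverse.Compatible from (proj₁ (Inverse.component from Γ))
    β-compatible Γ = proj₂ (Inverse.component from Γ)
    extension : F ≃ G
    extension = record
      { iso = λ Γ → record
        { to   = proj₁ (component to Γ)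
        ; from = proj₁ (Inverse.component from Γ)
        ; isoˡ = compatible-inverse C F F-reg G G-reg to from (λ t → Iso.isoˡ (φ t))
                   (α-compatible Γ) (β-compatible Γ)
        ; isoʳ = compatible-inverse C G G-reg F F-reg from to (λ t → Iso.isoʳ (φ t))
                   (β-compatible Γ) (α-compatible Γ)
        }
      ; natural = λ {Γ} {Δ} f → compatible⇒natural to (α-compatible Γ) (α-compatible Δ) f
      }
    idᶠ : ∀ {Γ} → Γ ⇒ Γ
    idᶠ = Category.idn (FRg T)
    -- Compatibility at the identity of `unit t` reads off the component there.
    extends : ∀ t → proj₁ (component to (unit t)) ≈ to t
    extends t = begin
      proj₁ (component to (unit t))                     ≈⟨ Equiv.trans (G.identity ⟩∘⟨refl) identityˡ ⟨
      G.F₁ idᶠ ∘ proj₁ (component to (unit t))          ≈⟨ α-compatible (unit t) idᶠ ⟩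
      to t ∘ F.F₁ idᶠ                                   ≈⟨ Equiv.trans (refl⟩∘⟨ F.identity) identityʳ ⟩
      to t                                              ∎
    natural⇒compatible : (β : F ≃ G) → (∀ t → _≃_.to β (unit t) ≈ to t) → ∀ {Γ} → Compatible to (_≃_.to β Γ)
    natural⇒compatible β β-extends g = Equiv.trans (Equiv.sym (_≃_.natural β g)) (β-extends _ ⟩∘⟨refl)

-- The counit

module Counit (C : Category o ℓ e) (reg : IsRegular C) where
  open Category C
  open HomReasoning C
  open RegularTheory C reg
  open IsRegular reg using (regularEpiStable)

  -- By axiom K, equalities of objects obtained along different routes act by the same morphism.
  arr-irrelevant : ∀ {A B} (p q : A ≡ B) → arr C p ≈ arr C q
  arr-irrelevant refl refl = Equiv.refl

  -- The interface of the product of all `τ Γ x` with the supports of the members of `S Γ`. Supports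
  -- being subterminal, maps into `object` are determined by their elements alone, while their
  -- existence also asks for maps to the supports.
  record Representation (Γ : Context Obj) : Set (o ⊔ ℓ ⊔ e) where
    field
      object     : Obj
      el         : ∀ x → Hom object (τ Γ x)
      su         : ∀ {s} → s ∈ S Γ → Hom object (supp s)
      mediate    : ∀ {X} → (∀ x → Hom X (τ Γ x)) → (∀ {s} → s ∈ S Γ → Hom X (supp s)) → Hom X object
      el-mediate : ∀ {X} (f : ∀ x → Hom X (τ Γ x)) (h : ∀ {s} → s ∈ S Γ → Hom X (supp s)) x →
                   el x ∘ mediate f h ≈ f x
      el-unique  : ∀ {X} {u v : Hom X object} → (∀ x → el x ∘ u ≈ el x ∘ v) → u ≈ v

  abstract
    productRepresentation : ∀ Γ → Representation Γ
    productRepresentation Γ = record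
      { object     = proj₁ (product factors)
      ; el         = λ x → π x ∘ pr zero
      ; su         = λ s∈ → arr C (cong supp (sym (lookup-index s∈))) ∘ ρ (Any.index s∈) ∘ pr (suc zero)
      ; mediate    = λ f h → proj₁ (P! (pair f h))
      ; el-mediate = λ f h x → Equiv.trans (pullʳ (proj₁ (proj₂ (P! (pair f h))) zero))
                                           (proj₁ (proj₂ (proj₂ (proj₂ els) f)) x)
      ; el-unique  = λ eq → product-unique C P! λ where
          zero       → product-unique C (proj₂ (proj₂ els)) λ x →
                         Equiv.trans (Equiv.sym assoc) (Equiv.trans (eq x) assoc)
          (suc zero) → product-unique C (proj₂ (proj₂ sus)) λ k → supp-subterminal (lookup (S Γ) k) _ _
      }
      where
      els : Product C (τ Γ)
      els = product (τ Γ)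
      sus : Product C (λ k → supp (lookup (S Γ) k))
      sus = product λ k → supp (lookup (S Γ) k)
      factors : Fin 2 → Obj
      factors zero    = proj₁ els
      factors (suc _) = proj₁ sus
      π : ∀ x → Hom (proj₁ els) (τ Γ x)
      π = proj₁ (proj₂ els)
      ρ : ∀ k → Hom (proj₁ sus) (supp (lookup (S Γ) k))
      ρ = proj₁ (proj₂ sus)
      pr : ∀ i → Hom (proj₁ (product factors)) (factors i)
      pr = proj₁ (proj₂ (product factors))
      P! : IsProduct C factors pr
      P! = proj₂ (proj₂ (product factors))
      pair : ∀ {X} (f : ∀ x → Hom X (τ Γ x)) (h : ∀ {s} → s ∈ S Γ → Hom X (supp s)) i → Hom X (factors i)
      pair f h zero       = proj₁ (proj₂ (proj₂ els) f)
      pair f h (suc zero) = proj₁ (proj₂ (proj₂ sus) λ k → h (∈-lookup k))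

  ∈-singleton : ∀ {s t u : Obj} → t ∈ [ s ] → u ∈ [ s ] → t ≡ u
  ∈-singleton (here refl) (here refl) = refl

  -- The first clause makes the counit strictly invert the unit on objects.
  representation : ∀ Γ → Representation Γ
  representation (ctx 1 (s ∷ []) τ τ∈S) = record
    { object     = τ zero
    ; el         = λ { zero → idn }
    -- Every member of the one-element list equals `τ zero`, so the object `τ zero` already maps to
    -- each required support by `cover`.
    ; su         = λ t∈ → arr C (cong supp (∈-singleton (τ∈S zero) t∈)) ∘ cover (τ zero)
    ; mediate    = λ f h → f zero
    ; el-mediate = λ { f h zero → identityˡ }
    ; el-unique  = λ eq → Equiv.trans (Equiv.sym identityˡ) (Equiv.trans (eq zero) identityˡ)
    }
  representation Γ = productRepresentation Γ

  open module Rep Γ = Representation (representation Γ) using (el; su; mediate; el-mediate; el-unique)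

  open Category (FRg Obj) using () renaming (idn to idnᶠ; _∘_ to _∘ᶠ_)

  F₀ : Context Obj → Obj
  F₀ Γ = Representation.object (representation Γ)

  F₁ : ∀ {Γ Δ} → Γ ⇒ Δ → Hom (F₀ Γ) (F₀ Δ)
  F₁ {Γ} {Δ} f = mediate Δ (λ x → arr C (τ-eq f x) ∘ el Γ (fun f x)) (λ s∈ → su Γ (S′⊆S f s∈))

  el-F₁ : ∀ {Γ Δ} (f : Γ ⇒ Δ) x → el Δ x ∘ F₁ f ≈ arr C (τ-eq f x) ∘ el Γ (fun f x)
  el-F₁ {Γ} {Δ} f = el-mediate Δ _ _

  el-cong : ∀ Γ {x y t} → x ≡ y → (p : τ Γ x ≡ t) (q : τ Γ y ≡ t) →
            arr C p ∘ el Γ x ≈ arr C q ∘ el Γ y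
  el-cong Γ refl p q = arr-irrelevant p q ⟩∘⟨refl

  functor : Functor (FRg Obj) C
  functor = record
    { F₀ = F₀
    ; F₁ = F₁
    ; F-resp-≈ = λ {Γ} {Δ} {f} {g} f≈g → el-unique Δ λ x → Equiv.trans (el-F₁ f x)
        (Equiv.trans (el-cong Γ (lower f≈g x) (τ-eq f x) (τ-eq g x)) (Equiv.sym (el-F₁ g x)))
    ; identity = λ {Γ} → el-unique Γ λ x →
        Equiv.trans (el-F₁ (idnᶠ {Γ}) x) (Equiv.trans identityˡ (Equiv.sym identityʳ))
    ; homomorphism = λ {Γ} {Δ} {Θ} {f} {g} → el-unique Θ λ x → begin
        el Θ x ∘ F₁ (g ∘ᶠ f)                      ≈⟨ el-F₁ (g ∘ᶠ f) x ⟩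
        arr C (trans (τ-eq f (fun g x)) (τ-eq g x)) ∘ el Γ (fun f (fun g x))
          ≈⟨ arr-trans C (τ-eq f (fun g x)) (τ-eq g x) _ ⟩
        arr C (τ-eq g x) ∘ arr C (τ-eq f (fun g x)) ∘ el Γ (fun f (fun g x))
          ≈⟨ refl⟩∘⟨ el-F₁ f (fun g x) ⟨
        arr C (τ-eq g x) ∘ el Δ (fun g x) ∘ F₁ f  ≈⟨ pullˡ (Equiv.sym (el-F₁ g x)) ⟩
        (el Θ x ∘ F₁ g) ∘ F₁ f                    ≈⟨ assoc ⟩
        el Θ x ∘ F₁ g ∘ F₁ f                      ∎
    }

  -- The counit preserves finite limits

  module _ {J : FiniteCategory} {E : Functor (FiniteCategory.category J) (FRg Obj)} {L : Cone E}
           (colim : IsColimiting E L) where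
    private
      module E = Functor E
      module L = Cone L
    open IsColimiting colim

    -- A cone `K` assigns a generalised element to every node, constant along steps. By `surjective`
    -- and `connected` this is the same as one element for each point of the apex, and `supported`
    -- provides the maps to supports.
    colimiting⇒limit-image : IsLimit (mapCone functor L)
    colimiting⇒limit-image K = mediator , commutes , λ {v} → unique v
      where
      module K = Cone K

      value : ∀ v → Hom K.apex (colour E v)
      value (j , x) = el (E.F₀ j) x ∘ K.ψ j

      _∼_ : Node E → Node E → Set _
      -- Values at different nodes may have different codomains and are compared along an equality
      -- of colours. As an equivalence relation containing the steps, this contains their closure.
      v ∼ w = Σ (colour E v ≡ colour E w) λ p → arr C p ∘ value v ≈ value w

      ∼-isEquivalence : IsEquivalence _∼_
      ∼-isEquivalence = record
        { refl  = refl , identityˡ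
        ; sym   = λ (p , eq) → sym p , arr-sym-cancel C p eq
        ; trans = λ (p , eq) (q , eq′) → trans p q ,
            Equiv.trans (arr-trans C p q _) (Equiv.trans (refl⟩∘⟨ eq) eq′)
        }

      step⇒∼ : ∀ {v w} → Step E v w → v ∼ w
      step⇒∼ {k , x} (u , refl) = IsEquivalence.sym ∼-isEquivalence (τ-eq (E.F₁ u) x , (begin
        arr C (τ-eq (E.F₁ u) x) ∘ el (E.F₀ _) (fun (E.F₁ u) x) ∘ K.ψ _
          ≈⟨ pullˡ (Equiv.sym (el-F₁ (E.F₁ u) x)) ⟩
        (el (E.F₀ k) x ∘ F₁ (E.F₁ u)) ∘ K.ψ _                           ≈⟨ pullʳ (K.commute u) ⟩
        el (E.F₀ k) x ∘ K.ψ k                                           ∎))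

      source-colour : ∀ {v x} → leg E L v ≡ x → colour E v ≡ τ L.apex x
      source-colour {v} p = trans (sym (leg-colour E L v)) (cong (τ L.apex) p)

      mediator : Hom K.apex (F₀ L.apex)
      mediator = mediate L.apex
        (λ x → let v , p = surjective x in arr C (source-colour {v} p) ∘ value v)
        (λ s∈ → let j , s∈Sj = supported s∈ in su (E.F₀ j) s∈Sj ∘ K.ψ j)

      commutes : ∀ j → F₁ (L.ψ j) ∘ mediator ≈ K.ψ j
      commutes j = el-unique (E.F₀ j) λ x →
        let v , p = surjective (fun (L.ψ j) x)
            q , eq = Eq.fold ∼-isEquivalence step⇒∼ (connected {v} {j , x} p)
        in begin
          el (E.F₀ j) x ∘ F₁ (L.ψ j) ∘ mediator                                    ≈⟨ pullˡ (el-F₁ (L.ψ j) x) ⟩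
          (arr C (τ-eq (L.ψ j) x) ∘ el L.apex (fun (L.ψ j) x)) ∘ mediator
            ≈⟨ pullʳ (el-mediate L.apex _ _ _) ⟩
          arr C (τ-eq (L.ψ j) x) ∘ arr C (source-colour {v} p) ∘ value v
            ≈⟨ arr-trans C (source-colour {v} p) (τ-eq (L.ψ j) x) _ ⟨
          arr C (trans (source-colour {v} p) (τ-eq (L.ψ j) x)) ∘ value v
            -- The equality read off the legs and the equality `q` found along the path of steps act
            -- alike.
            ≈⟨ arr-irrelevant (trans (source-colour {v} p) (τ-eq (L.ψ j) x)) q ⟩∘⟨refl ⟩
          arr C q ∘ value v                                               ≈⟨ eq ⟩
          el (E.F₀ j) x ∘ K.ψ j                                                    ∎

      unique : ∀ v → (∀ j → F₁ (L.ψ j) ∘ v ≈ K.ψ j) → mediator ≈ v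
      unique v eq = el-unique L.apex λ y →
        Equiv.trans (el-mediate L.apex _ _ y) (determined (proj₁ (surjective y)) (proj₂ (surjective y)))
        where
        determined : ∀ w {y} (p : leg E L w ≡ y) → arr C (source-colour {w} p) ∘ value w ≈ el L.apex y ∘ v
        determined (j , x) refl = Equiv.trans
          (arr-irrelevant (source-colour {j , x} refl) (sym (τ-eq (L.ψ j) x)) ⟩∘⟨refl)
          (arr-sym-cancel C (τ-eq (L.ψ j) x) (begin
            arr C (τ-eq (L.ψ j) x) ∘ el L.apex (fun (L.ψ j) x) ∘ v  ≈⟨ pullˡ (Equiv.sym (el-F₁ (L.ψ j) x)) ⟩
            (el (E.F₀ j) x ∘ F₁ (L.ψ j)) ∘ v                          ≈⟨ pullʳ (eq j) ⟩
            el (E.F₀ j) x ∘ K.ψ j                                     ∎))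

  -- The counit preserves regular epimorphisms

  regularEpi-resp-≈ : ∀ {A B} {c d : Hom A B} → c ≈ d → IsRegularEpi C c → IsRegularEpi C d
  regularEpi-resp-≈ c≈d (K , p , q , cp≈cq , factor) = K , p , q ,
    Equiv.trans (Equiv.sym c≈d ⟩∘⟨refl) (Equiv.trans cp≈cq (c≈d ⟩∘⟨refl)) ,
    λ h hp≈hq → let u , uc , unique = factor h hp≈hq in
      u , Equiv.trans (refl⟩∘⟨ Equiv.sym c≈d) uc , λ vd → unique (Equiv.trans (refl⟩∘⟨ c≈d) vd)

  module _ (Δ : Context Obj) (t : Obj) (t∈S : t ∈ S Δ) where

    Δ+t : Context Obj
    Δ+t = adjoin Δ {1} (λ _ → t) (λ _ → t∈S)

    forget₁ : Δ+t ⇒ Δ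
    forget₁ = forget Δ {1} (λ _ → t) (λ _ → t∈S)

    private
      F-Δ+t = F₀ Δ+t

      newElement : Hom F-Δ+t t
      newElement = el Δ+t zero

      el-forget : ∀ x → el Δ x ∘ F₁ forget₁ ≈ el Δ+t (suc x)
      el-forget x = Equiv.trans (el-F₁ forget₁ x)
        (Equiv.trans (arr-irrelevant (τ-eq forget₁ x) refl ⟩∘⟨refl) identityˡ)

      -- Adjoining `t` multiplies the image of `Δ` by `t`. Over a subterminal object every square
      -- commutes, so this product is also the pullback over `supp t`, and `F₁ forget₁` is a
      -- pullback of `cover t`.
      forget-pullback : IsPullback C newElement (F₁ forget₁) (cover t) (su Δ t∈S)
      forget-pullback = supp-subterminal t _ _ , λ {X} h k _ →
        let f : ∀ x → Hom X (τ Δ+t x)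
            f = λ { zero → h ; (suc x) → el Δ x ∘ k }
            u = mediate Δ+t f (λ s∈ → su Δ s∈ ∘ k)
            el-u = el-mediate Δ+t f (λ s∈ → su Δ s∈ ∘ k)
        in u , (el-u zero , el-unique Δ λ x → Equiv.trans (pullˡ (el-forget x)) (el-u (suc x))) ,
           λ (ph , qk) → el-unique Δ+t λ where
             zero    → Equiv.trans (el-u zero) (Equiv.sym ph)
             (suc x) → Equiv.trans (el-u (suc x)) (Equiv.trans (refl⟩∘⟨ Equiv.sym qk) (pullˡ (el-forget x)))

    forget₁-regularEpi : IsRegularEpi C (F₁ forget₁)
    forget₁-regularEpi = regularEpiStable forget-pullback (cover-regularEpi t)

  -- Elements of Γ missing from Δ are added one at a time.
  cover⇒regularEpi-image : ∀ d {Γ Δ : Context Obj} (c : Γ ⇒ Δ) → IsCover c → n Γ ℕ.≤ n Δ ℕ.+ d →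
                           IsRegularEpi C (F₁ c)
  cover⇒regularEpi-image d {Γ} {Δ} c (injective , S⊆) bound
    with any? (λ y → ¬? (any? λ x → fun c x ≟ y))
  -- With nothing missing, `fun c` is a bijection and `c` an isomorphism.
  ... | no ¬missing = iso⇒regularEpi C (F₁ c⁻¹)
          (inverse c⁻¹ c λ x → proj₂ (preimage x)) (inverse c c⁻¹ λ x → injective (proj₂ (preimage (fun c x))))
    where
    preimage : ∀ y → ∃ λ x → fun c x ≡ y
    preimage y = decidable-stable (any? λ x → fun c x ≟ y) λ ¬hit → ¬missing (y , ¬hit)
    c⁻¹ : Δ ⇒ Γ
    c⁻¹ = mk⇒ S⊆ (λ y → proj₁ (preimage y))
              (λ y → trans (sym (τ-eq c _)) (cong (τ Γ) (proj₂ (preimage y))))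
    inverse : ∀ {Γ Δ} (f : Γ ⇒ Δ) (g : Δ ⇒ Γ) → (∀ x → fun g (fun f x) ≡ x) → F₁ f ∘ F₁ g ≈ idn
    inverse {Δ = Δ} f g eq = Equiv.trans (Equiv.sym (Functor.homomorphism functor {f = g} {g = f}))
      (Equiv.trans (Functor.F-resp-≈ functor {f = f ∘ᶠ g} {g = idnᶠ {Δ}} (lift eq))
                   (Functor.identity functor {Δ}))
  -- The missing point `y` is adjoined to `Δ`, and `c` factors as `c′` followed by `forget₁`. The
  -- number `d` bounds how many points are still missing.
  ... | yes (y , ¬hit) = factorize d bound
    where
    t∈S : τ Γ y ∈ S Δ
    t∈S = S⊆ (τ∈S Γ y)
    c′ : Γ ⇒ Δ+t Δ (τ Γ y) t∈S
    c′ = mk⇒ (S′⊆S c) (λ { zero → y ; (suc x) → fun c x }) (λ { zero → refl ; (suc x) → τ-eq c x })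
    c′-injective : Injective _≡_ _≡_ (fun c′)
    c′-injective {zero}  {zero}  _  = refl
    c′-injective {zero}  {suc _} eq = contradiction (_ , sym eq) ¬hit
    c′-injective {suc _} {zero}  eq = contradiction (_ , eq) ¬hit
    c′-injective {suc _} {suc _} eq = cong suc (injective eq)
    factorize : ∀ d → n Γ ℕ.≤ n Δ ℕ.+ d → IsRegularEpi C (F₁ c)
    -- Injectivity of `c′` embeds `n Δ + 1` points into `n Γ`, which the bound limits to `n Δ`.
    factorize zero    bound = contradiction
      (ℕ.≤-trans (injective⇒≤ c′-injective) (ℕ.≤-trans bound (ℕ.≤-reflexive (ℕ.+-identityʳ _)))) ℕ.1+n≰n
    factorize (suc d) bound = regularEpi-resp-≈
      (Equiv.trans (Equiv.sym (Functor.homomorphism functor {f = c′} {g = forget₁ Δ (τ Γ y) t∈S}))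
                   (Functor.F-resp-≈ functor {f = forget₁ Δ (τ Γ y) t∈S ∘ᶠ c′} {g = c} (lift λ _ → refl)))
      (∘-regularEpi (cover⇒regularEpi-image d c′ (c′-injective , S⊆)
                      (ℕ.≤-trans bound (ℕ.≤-reflexive (ℕ.+-suc _ _))))
                    (forget₁-regularEpi Δ (τ Γ y) t∈S))

  isRegular : IsRegularFunctor functor
  isRegular = record
    { preservesFiniteLimits = λ J {E} L lim → colimiting⇒limit-image {L = L} (limit⇒colimiting E {L = L} lim)
    ; preservesRegularEpis  = λ {Γ} {Δ} {c} c-epi →
        cover⇒regularEpi-image (n Γ) c (regularEpi⇒cover {c = c} c-epi) (ℕ.m≤n+m (n Γ) (n Δ))
    }

-- Assembly of the adjunction

∘F-isRegular : ∀ {o ℓ e o′ ℓ′ e′ o″ ℓ″ e″}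
               {C : Category o ℓ e} {D : Category o′ ℓ′ e′} {E : Category o″ ℓ″ e″}
               {G : Functor D E} {F : Functor C D} →
               IsRegularFunctor G → IsRegularFunctor F → IsRegularFunctor (G ∘F F)
∘F-isRegular {G = G} {F} G-reg F-reg = record
  { preservesFiniteLimits = λ J L lim K →
      G-reg.preservesFiniteLimits J (mapCone F L) (F-reg.preservesFiniteLimits J L lim)
        -- The two bracketings of the composite diagram agree on objects and morphisms but differ in
        -- their proofs of the functor laws, so the cone is repackaged.
        (record { apex = Cone.apex K ; ψ = Cone.ψ K ; commute = Cone.commute K })
  ; preservesRegularEpis = λ c-epi → G-reg.preservesRegularEpis (F-reg.preservesRegularEpis c-epi)
  }
  where
  module G-reg = IsRegularFunctor G-reg
  module F-reg = IsRegularFunctor F-reg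

idF-isRegular : ∀ {C : Category o ℓ e} → IsRegularFunctor (idF {C = C})
idF-isRegular = record
  { preservesFiniteLimits = λ J L lim K →
      lim (record { apex = Cone.apex K ; ψ = Cone.ψ K ; commute = Cone.commute K })
  ; preservesRegularEpis = id
  }

module _ {C : Category o ℓ e} where
  open Category C

  ≡⇒Iso : ∀ {A B} → A ≡ B → Iso C A B
  ≡⇒Iso refl = record { to = idn ; from = idn ; isoˡ = identityˡ ; isoʳ = identityˡ }

theorem23 : (a : Level) →
    Σ ((T : Set a) → IsRegular (FRg T)) λ regular →
    Σ (∀ {T T′ : Set a} (g : T → T′) → IsRegularFunctor (FRg₁ g)) λ preserves →
    FRgᴿ regular preserves ⊣Ob
theorem23 a = (λ _ → FRg-isRegular) , FRg₁-isRegular , record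
  { functorial = record
    -- Here and below, parallel regular functors out of a free category are compared on units, where
    -- their values are equal.
    { L-resp-≡       = λ {_} {_} {g} {h} g≡h →
        extend (FRg₁-isRegular g) (FRg₁-isRegular h) λ t → ≡⇒Iso (cong unit (g≡h t))
    ; L-identity     = extend (FRg₁-isRegular id) idF-isRegular λ t → ≡⇒Iso refl
    ; L-homomorphism = λ g h →
        extend (FRg₁-isRegular (λ t → h (g t)))
               (∘F-isRegular (FRg₁-isRegular h) (FRg₁-isRegular g))
               λ t → ≡⇒Iso refl
    }
  ; η         = λ _ → unit
  ; ε         = λ R → record { functor = counit R ; isRegular = counit-isRegular R }
  ; η-natural = λ _ _ → refl
  ; ε-natural = λ {R} {R′} H →
      extend (∘F-isRegular (counit-isRegular R′) (FRg₁-isRegular (RegularFunctor.F₀ H)))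
             (∘F-isRegular (RegularFunctor.isRegular H) (counit-isRegular R)) λ t → ≡⇒Iso refl
  ; zig       = λ T → extend (∘F-isRegular (counit-isRegular (free T)) (FRg₁-isRegular unit)) idF-isRegular
                        λ t → ≡⇒Iso refl
  -- Definitional, by the special clause of `representation` for one point and a one-element list.
  ; zag       = λ _ _ → refl
  ; extendIso = λ F G φ → extendIso _ _ (RegularFunctor.isRegular F) _ (RegularFunctor.isRegular G) φ
  }
  where
  free : Set a → RegularCategory a
  free T = record { category = FRg T ; isRegular = FRg-isRegular }

  extend : ∀ {T : Set a} {C : Category a a a} {F G : Functor (FRg T) C} →
           IsRegularFunctor F → IsRegularFunctor G →
           (∀ t → Iso C (Functor.F₀ F (unit t)) (Functor.F₀ G (unit t))) → F ≃ G
  extend F-reg G-reg φ = proj₁ (extendIso _ _ F-reg _ G-reg φ)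

  counit : (R : RegularCategory a) → Functor (FRg (RegularCategory.Obj R)) (RegularCategory.category R)
  counit R = Counit.functor (RegularCategory.category R) (RegularCategory.isRegular R)

  counit-isRegular : ∀ R → IsRegularFunctor (counit R)
  counit-isRegular R = Counit.isRegular (RegularCategory.category R) (RegularCategory.isRegular R)
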